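{- Let $n\ge 6$ and let $F$ be a subgraph of the convex complete graph $K_n$ such that $|E(F)|\le n-2$ and $F$ contains no boundary edge of $K_n$. Then $K_n - F$ admits a triangulation unless $F$ has configuration $\mathcal{F}_n(*)$.
   Context: A convex complete graph $K_m$ is the complete graph on $m$ points in convex position in the plane, edges drawn as straight-line segments. Boundary edges are edges joining vertices consecutive along the convex hull boundary. Two edges with four distinct endpoints cross if the segments intersect, i.e. their endpoints alternate along the boundary. $K_m-F$ denotes the convex graph obtained from $K_m$ by deleting the edges of the subgraph $F$ (all $m$ vertices kept). A convex graph $G$ on $m$ vertices admits a triangulation if it contains a maximal plane straight-line subdivision on vertex set $V(G)$, i.e. $G$ contains all $m$ boundary edges and $m-3$ pairwise non-crossing diagonals. $d_F(v)$ is the degree of $v$ in $F$; a pendant vertex of $F$ is one of degree $1$ in $F$. Configuration $\mathcal{F}_m(*)$: a subgraph $F$ of $K_m$ has this configuration if $F$ has exactly $m-2$ edges, has no isolated vertices (every vertex of $K_m$ meets an edge of $F$), and for some labelling $v_0,\dots,v_{m-1}$ of the vertices of $K_m$ in cyclic order along the boundary (subscripts mod $m$), either (a) $E(F)=\{v_0v_i: i=2,\dots,m-2\}\cup\{v_1v_{m-1}\}$, or (b) there is an integer $k$ with $2\le k\le m-4$ such that: (i) for $i=0,1,\dots,k-1$, $d_F(v_i)\ge 2$ and $v_{i-1}v_{i+1}\in E(F)$; (ii) for $i=k,\dots,m-1$, $d_F(v_i)=1$ and $v_i$ is adjacent in $F$ to a non-pendant vertex of $F$; (iii) whenever $u,v$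 are pendant vertices of $F$ such that the edges $uv_i$ and $vv_j$ of $F$ cross, then $|i-j|=1$. -}

module Defs where

open import Data.Nat using (ℕ; zero; suc; _+_; _∸_; _≤_; _<_; _%_)
open import Data.Nat.DivMod using (m%n<n)
open import Data.Fin using (Fin; toℕ; fromℕ<) renaming (_≟_ to _≟ᶠ_)
open import Data.Bool using (Bool; true; false; if_then_else_)
open import Data.Product using (Σ; _×_; _,_; proj₁; proj₂)
open import Data.Sum using (_⊎_)
open import Data.List using (List; []; _∷_; length)
open import Data.List.Relation.Unary.All using (All)
open import Data.List.Relation.Unary.AllPairs using (AllPairs)
open import Data.List.Relation.Unary.Unique.Propositional using (Unique)
open import Data.List.Membership.Propositional using (_∈_)
open import Relation.Nullary using (¬_; does)
open import Relation.Binary.PropositionalEquality using (_≡_; _≢_)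

-- Vertices of the convex K_n are Fin n, in cyclic order 0,1,...,n-1 along the boundary.
-- An edge is a pair (a , b) with toℕ a < toℕ b.
Edge : ℕ → Set
Edge n = Fin n × Fin n

Normalised : ∀ {n} → Edge n → Set
Normalised (a , b) = toℕ a < toℕ b

-- A (spanning) subgraph of K_n given by its edge set: a duplicate-free list of normalised edges.
EdgeSet : ℕ → Set
EdgeSet n = List (Edge n)

WellFormed : ∀ {n} → EdgeSet n → Set
WellFormed F = All Normalised F × Unique F

Adj : ∀ {n} → EdgeSet n → Fin n → Fin n → Set
Adj F x y = ((x , y) ∈ F) ⊎ ((y , x) ∈ F)

deg : ∀ {n} → EdgeSet n → Fin n → ℕ
deg [] v = 0
deg ((a , b) ∷ F) v =
  if does (v ≟ᶠ a) then suc (deg F v) else (if does (v ≟ᶠ b) then suc (deg F v) else deg F v)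

-- labelling v_i of the vertices in cyclic order along the boundary, starting at s,
-- going in increasing direction (dir = true) or decreasing direction (dir = false);
-- subscripts are taken mod n.
vtx : ∀ {n} → Fin n → Bool → ℕ → Fin n
vtx {suc n} s true  i = fromℕ< (m%n<n (toℕ s + i) (suc n))
vtx {suc n} s false i = fromℕ< (m%n<n (toℕ s + (suc n ∸ (i % suc n))) (suc n))

next : ∀ {n} → Fin n → Fin n
next s = vtx s true 1

Between : ℕ → ℕ → ℕ → Set
Between x y z = (x < z × z < y) ⊎ (y < z × z < x)

Outside : ℕ → ℕ → ℕ → Set
Outside x y z = ((z < x × z < y) ⊎ (x < z × y < z))

-- the segments ab and cd cross: four distinct endpoints alternating along the boundary
Cross : ∀ {n} → Fin n → Fin n → Fin n → Fin n → Set
Cross a b c d =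
  (Between (toℕ a) (toℕ b) (toℕ c) × Outside (toℕ a) (toℕ b) (toℕ d)) ⊎
  (Between (toℕ a) (toℕ b) (toℕ d) × Outside (toℕ a) (toℕ b) (toℕ c))

IsBoundary : ∀ {n} → Fin n → Fin n → Set
IsBoundary a b = (b ≡ next a) ⊎ (a ≡ next b)

IsDiagonal : ∀ {n} → Edge n → Set
IsDiagonal (a , b) = (a ≢ b) × ¬ IsBoundary a b

AdmitsTriangulation : ∀ n → EdgeSet n → Set
AdmitsTriangulation n F =
  (∀ (i : Fin n) → ¬ Adj F i (next i)) ×
  Σ (EdgeSet n) λ D →
    WellFormed D × All IsDiagonal D × All (λ e → ¬ Adj F (proj₁ e) (proj₂ e)) D ×
    length D ≡ n ∸ 3 ×
    AllPairs (λ e f → ¬ Cross (proj₁ e) (proj₂ e) (proj₁ f) (proj₂ f)) D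

SameEdge : ∀ {n} → Fin n → Fin n → Fin n → Fin n → Set
SameEdge x y a b = (x ≡ a × y ≡ b) ⊎ (x ≡ b × y ≡ a)

ConfigA : ∀ n → EdgeSet n → Fin n → Bool → Set
ConfigA n F s dir =
  ∀ x y →
    (Adj F x y →
      (Σ ℕ λ i → 2 ≤ i × i ≤ n ∸ 2 × SameEdge x y (v 0) (v i)) ⊎ SameEdge x y (v 1) (v (n ∸ 1))) ×
    ((Σ ℕ λ i → 2 ≤ i × i ≤ n ∸ 2 × SameEdge x y (v 0) (v i)) ⊎ SameEdge x y (v 1) (v (n ∸ 1)) →
      Adj F x y)
  where v = vtx s dir

ConfigB : ∀ n → EdgeSet n → Fin n → Bool → Set
ConfigB n F s dir =
  Σ ℕ λ k → 2 ≤ k × k ≤ n ∸ 4 ×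
    (∀ i → i < k → 2 ≤ deg F (v i) × Adj F (v (i + n ∸ 1)) (v (suc i))) ×
    (∀ i → k ≤ i → i < n →
       deg F (v i) ≡ 1 × Σ (Fin n) λ w → Adj F (v i) w × deg F w ≢ 1) ×
    (∀ (u w : Fin n) (i j : ℕ) → i < n → j < n →
       deg F u ≡ 1 → deg F w ≡ 1 → Adj F u (v i) → Adj F w (v j) →
       Cross u (v i) w (v j) → (i ≡ suc j) ⊎ (j ≡ suc i))
  where v = vtx s dir

HasConfigStar : ∀ n → EdgeSet n → Set
HasConfigStar n F =
  length F ≡ n ∸ 2 × (∀ (x : Fin n) → 1 ≤ deg F x) ×
  Σ (Fin n) λ s → Σ Bool λ dir → ConfigA n F s dir ⊎ ConfigB n F s dir

{-# OPTIONS --safe #-}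
-- Suppose the edges of F block every triangulation.
--
-- Sparse graphs never block: on m points with at most m - 3 forbidden edges, either some vertex meets
-- none of them and its fan is free, or all degrees are positive and one cuts off an ear carrying a
-- forbidden edge, next to a vertex of degree 1. Hence F has exactly n - 2 edges, has no isolated vertex,
-- and the ear chord at every vertex of degree ≥ 2 lies in F. The degree sum 2n - 4 leaves many pendant
-- vertices, and the fan of a pendant vertex misses only one chord, so fans from two pendant vertices,
-- glued along a chord or a triangle, triangulate in each of the following situations:
-- * u, w pendant and adjacent, with a free chord xy across uw; otherwise some side of uw has a single
--   vertex, and this is configuration (a);
-- * two distinct pendant vertices each preceded by a non-pendant one; otherwise the non-pendant
--   vertices are consecutive, v₀, …, v_{k-1};
-- * two pendant vertices whose edges to v_i and v_j cross with |i - j| ≥ 2.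
-- If none of them occurs, F has configuration (b).
module Submission where

open import Defs
open import Data.Nat using (ℕ; zero; suc; _+_; _*_; _∸_; _≤_; _<_; z≤n; s≤s; _≤?_; _%_)
open import Data.Nat.Properties
open import Data.Nat.DivMod using (m<n⇒m%n≡m; n%n≡0; m%n%n≡m%n; m%n<n; [m+n]%n≡m%n; %-distribˡ-+)
open import Data.Nat.ListAction using (sum)
open import Data.Nat.ListAction.Properties using (sum-++)
open import Data.Nat.Solver using (module +-*-Solver)
open import Data.Bool using (true; if_then_else_)
open import Data.Empty using (⊥; ⊥-elim)
open import Data.Unit using (⊤; tt)
open import Data.Fin using (Fin; toℕ) renaming (_≟_ to _≟ᶠ_)
open import Data.Fin.Properties using (toℕ-fromℕ<; toℕ<n; toℕ-injective; any?; all?)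
open import Data.Product as Product using (Σ; ∃; _×_; _,_; proj₁; proj₂)
open import Data.Product.Properties using (≡-dec)
open import Data.Sum as Sum using (_⊎_; inj₁; inj₂)
open import Data.List using (List; []; _∷_; _++_; length; map)
open import Data.List.Properties using (++-assoc; ++-identityʳ; map-++)
open import Data.List.Membership.Propositional using (_∈_; find; lose)
open import Data.List.Membership.Propositional.Properties using (∈-∃++; ∈-++⁺ʳ)
open import Data.List.Relation.Unary.All as All using (All; []; _∷_)
open import Data.List.Relation.Unary.AllPairs as AllPairs using (AllPairs; []; _∷_)
open import Data.List.Relation.Unary.AllPairs.Properties using (++⁺)
open import Data.List.Relation.Unary.Any as Any using (here; there)
open import Data.List.Relation.Unary.Unique.Propositional using (Unique)
open import Data.List.Relation.Binary.Permutation.Propositional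
  using (_↭_; ↭-sym; ↭-trans; ↭-refl; ↭-swap; ↭⇒↭ₛ)
open import Data.List.Relation.Binary.Permutation.Propositional.Properties
  using (∈-resp-↭; ↭-length; ++-comm; shift)
open import Relation.Nullary using (¬_; Dec; yes; no; does; contradiction; ¬?; _×-dec_; _⊎-dec_)
open import Relation.Nullary.Decidable using (map′; decidable-stable)
open import Relation.Binary using (tri<; tri≈; tri>)
open import Relation.Binary.PropositionalEquality

-- Degrees

adj-sym : ∀ {n} {F : EdgeSet n} {x y} → Adj F x y → Adj F y x
adj-sym = Sum.swap

adj? : ∀ {n} (F : EdgeSet n) x y → Dec (Adj F x y)
adj? {n} F x y = ((x , y) ∈? F) ⊎-dec ((y , x) ∈? F)
  where open import Data.List.Membership.DecPropositional (≡-dec (_≟ᶠ_ {n}) _≟ᶠ_)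

adj-uncons : ∀ {n} {F : EdgeSet n} {a b x y} →
  Adj ((a , b) ∷ F) x y → SameEdge x y a b ⊎ Adj F x y
adj-uncons (inj₁ (here refl)) = inj₁ (inj₁ (refl , refl))
adj-uncons (inj₁ (there p)) = inj₂ (inj₁ p)
adj-uncons (inj₂ (here refl)) = inj₁ (inj₂ (refl , refl))
adj-uncons (inj₂ (there p)) = inj₂ (inj₂ p)

deg-incident : ∀ {n} (F : EdgeSet n) {a b v} → v ≡ a ⊎ v ≡ b →
  deg ((a , b) ∷ F) v ≡ suc (deg F v)
deg-incident F {a} {b} {v} i with v ≟ᶠ a | v ≟ᶠ b
... | yes _ | _ = refl
... | no _ | yes _ = refl
... | no p | no q = ⊥-elim (Sum.[ p , q ] i)

deg-mono : ∀ {n} (F : EdgeSet n) e v → deg F v ≤ deg (e ∷ F) v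
deg-mono F (a , b) v with v ≟ᶠ a | v ≟ᶠ b
... | yes _ | _ = n≤1+n _
... | no _ | yes _ = n≤1+n _
... | no _ | no _ = ≤-refl

adj⇒1≤deg : ∀ {n} (F : EdgeSet n) {x y} → Adj F x y → 1 ≤ deg F x
adj⇒1≤deg [] (inj₁ ())
adj⇒1≤deg [] (inj₂ ())
adj⇒1≤deg ((a , b) ∷ F) r with adj-uncons r
... | inj₁ (inj₁ (p , _)) = subst (1 ≤_) (sym (deg-incident F (inj₁ p))) (s≤s z≤n)
... | inj₁ (inj₂ (p , _)) = subst (1 ≤_) (sym (deg-incident F (inj₂ p))) (s≤s z≤n)
... | inj₂ r′ = ≤-trans (adj⇒1≤deg F r′) (deg-mono F (a , b) _)

adj²⇒2≤deg : ∀ {n} (F : EdgeSet n) {x y z} → Adj F x y → Adj F x z → y ≢ z → 2 ≤ deg F x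
adj²⇒2≤deg [] (inj₁ ()) _ _
adj²⇒2≤deg [] (inj₂ ()) _ _
adj²⇒2≤deg ((a , b) ∷ F) {x} {y} {z} r s y≢z with adj-uncons r | adj-uncons s
... | inj₂ r′ | inj₂ s′ = ≤-trans (adj²⇒2≤deg F r′ s′ y≢z) (deg-mono F (a , b) x)
... | inj₁ e | inj₂ s′ = subst (2 ≤_) (sym (deg-incident F (Sum.map proj₁ proj₁ e))) (s≤s (adj⇒1≤deg F s′))
... | inj₂ r′ | inj₁ e = subst (2 ≤_) (sym (deg-incident F (Sum.map proj₁ proj₁ e))) (s≤s (adj⇒1≤deg F r′))
... | inj₁ (inj₁ (_ , p)) | inj₁ (inj₁ (_ , q)) = contradiction (trans p (sym q)) y≢z
... | inj₁ (inj₁ (o , p)) | inj₁ (inj₂ (o′ , q)) = contradiction (trans p (trans (sym o′) (trans o (sym q)))) y≢z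
... | inj₁ (inj₂ (o , p)) | inj₁ (inj₁ (o′ , q)) = contradiction (trans p (trans (sym o′) (trans o (sym q)))) y≢z
... | inj₁ (inj₂ (_ , p)) | inj₁ (inj₂ (_ , q)) = contradiction (trans p (sym q)) y≢z

del : ∀ {n} → Fin n → EdgeSet n → EdgeSet n
del x [] = []
del x ((a , b) ∷ F) =
  if does (x ≟ᶠ a) then del x F else (if does (x ≟ᶠ b) then del x F else (a , b) ∷ del x F)

deg+length-del : ∀ {n} x (F : EdgeSet n) → deg F x + length (del x F) ≡ length F
deg+length-del x [] = refl
deg+length-del x ((a , b) ∷ F) with x ≟ᶠ a | x ≟ᶠ b
... | yes _ | _ = cong suc (deg+length-del x F)
... | no _ | yes _ = cong suc (deg+length-del x F)
... | no _ | no _ = trans (+-suc (deg F x) _) (cong suc (deg+length-del x F))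

∈-del : ∀ {n} (F : EdgeSet n) {x a b} → a ≢ x → b ≢ x → (a , b) ∈ F → (a , b) ∈ del x F
∈-del ((a , b) ∷ F) {x} p q (here refl) with x ≟ᶠ a | x ≟ᶠ b
... | yes r | _ = contradiction (sym r) p
... | no _ | yes r = contradiction (sym r) q
... | no _ | no _ = here refl
∈-del ((c , d) ∷ F) {x} p q (there i) with x ≟ᶠ c | x ≟ᶠ d
... | yes _ | _ = ∈-del F p q i
... | no _ | yes _ = ∈-del F p q i
... | no _ | no _ = there (∈-del F p q i)

adj-del : ∀ {n} (F : EdgeSet n) {x a b} → a ≢ x → b ≢ x → Adj F a b → Adj (del x F) a b
adj-del F p q = Sum.map (∈-del F p q) (∈-del F q p)

-- Degree sums and vertices of low degree

occ : ∀ {n} → Fin n → List (Fin n) → ℕ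
occ a [] = 0
occ a (v ∷ L) = (if does (v ≟ᶠ a) then 1 else 0) + occ a L

occ-absent : ∀ {n} (a : Fin n) L → All (a ≢_) L → occ a L ≡ 0
occ-absent a [] [] = refl
occ-absent a (v ∷ L) (a≢v ∷ ps) with v ≟ᶠ a
... | yes v≡a = contradiction (sym v≡a) a≢v
... | no _ = occ-absent a L ps

occ≤1 : ∀ {n} (a : Fin n) L → Unique L → occ a L ≤ 1
occ≤1 a [] [] = z≤n
occ≤1 a (v ∷ L) (p ∷ u) with v ≟ᶠ a
... | yes refl = s≤s (≤-reflexive (occ-absent a L p))
... | no _ = occ≤1 a L u

-- An inequality, since `deg` counts a loop once whereas `occ a L + occ b L` counts it twice.
sum-deg-∷ : ∀ {n} (F : EdgeSet n) a b L →
  sum (map (deg ((a , b) ∷ F)) L) ≤ occ a L + occ b L + sum (map (deg F) L)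
sum-deg-∷ F a b [] = z≤n
sum-deg-∷ F a b (v ∷ L) = begin
  deg ((a , b) ∷ F) v + sum (map (deg ((a , b) ∷ F)) L)
    ≤⟨ +-mono-≤ deg≤ (sum-deg-∷ F a b L) ⟩
  (i + j + d) + (occ a L + occ b L + s)
    ≡⟨ solve 6 (λ i j d p q s → (i :+ j :+ d) :+ (p :+ q :+ s) := (i :+ p) :+ (j :+ q) :+ (d :+ s)) refl i j d (occ a L) (occ b L) s ⟩
  (i + occ a L) + (j + occ b L) + (d + s) ∎
  where
  open ≤-Reasoning
  open +-*-Solver
  i = if does (v ≟ᶠ a) then 1 else 0
  j = if does (v ≟ᶠ b) then 1 else 0
  d = deg F v
  s = sum (map (deg F) L)
  deg≤ : deg ((a , b) ∷ F) v ≤ i + j + d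
  deg≤ with v ≟ᶠ a | v ≟ᶠ b
  ... | yes _ | _ = s≤s (m≤n+m d _)
  ... | no _ | yes _ = ≤-refl
  ... | no _ | no _ = ≤-refl

sum-deg≤ : ∀ {n} (F : EdgeSet n) {L} → Unique L → sum (map (deg F) L) ≤ length F + length F
sum-deg≤ [] {L} _ = ≤-reflexive (zeros L)
  where
  zeros : ∀ L → sum (map (deg []) L) ≡ 0
  zeros [] = refl
  zeros (_ ∷ L) = zeros L
sum-deg≤ ((a , b) ∷ F) {L} u = begin
  sum (map (deg ((a , b) ∷ F)) L)         ≤⟨ sum-deg-∷ F a b L ⟩
  occ a L + occ b L + sum (map (deg F) L) ≤⟨ +-mono-≤ (+-mono-≤ (occ≤1 a L u) (occ≤1 b L u)) (sum-deg≤ F u) ⟩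
  2 + (length F + length F)               ≡⟨ cong suc (sym (+-suc (length F) (length F))) ⟩
  suc (length F) + suc (length F) ∎
  where open ≤-Reasoning

length*≤sum : ∀ {A : Set} (f : A → ℕ) c L → (∀ {x} → x ∈ L → c ≤ f x) → length L * c ≤ sum (map f L)
length*≤sum f c [] h = z≤n
length*≤sum f c (x ∷ L) h = +-mono-≤ (h (here refl)) (length*≤sum f c L (λ i → h (there i)))

-- Degrees of at least 2 throughout `L` would push the degree sum above `2 * length F`.
low-degree : ∀ {n} (F : EdgeSet n) {L} → Unique L → length F < length L →
  ∃ λ v → v ∈ L × deg F v ≤ 1
low-degree F {L} u F<L with Any.any? (λ v → deg F v ≤? 1) L
... | yes p = find p
... | no ¬p = contradiction chain (<⇒≱ (+-mono-< F<L F<L))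
  where
  open ≤-Reasoning
  chain : length L + length L ≤ length F + length F
  chain = begin
    length L + length L    ≡⟨ cong (length L +_) (sym (+-identityʳ _)) ⟩
    2 * length L           ≡⟨ *-comm 2 (length L) ⟩
    length L * 2           ≤⟨ length*≤sum (deg F) 2 L (λ i → ≰⇒> (λ d → ¬p (lose i d))) ⟩
    sum (map (deg F) L)    ≤⟨ sum-deg≤ F u ⟩
    length F + length F ∎

-- Triangulating sparse graphs by cutting ears

-- The list is a polygon in cyclic order. `cut` removes the ear `b` along a chord outside `R`; `rot`
-- changes the starting point, so ears need only be cut at the head.
data Tri {V : Set} (R : V → V → Set) : List V → Set where
  small : ∀ {L} → length L ≤ 3 → Tri R L
  cut   : ∀ {a b c L} → ¬ R a c → Tri R (a ∷ c ∷ L) → Tri R (a ∷ b ∷ c ∷ L)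
  rot   : ∀ A B → Tri R (B ++ A) → Tri R (A ++ B)

fan : ∀ {V : Set} {R : V → V → Set} {x} L → (∀ {y} → y ∈ L → ¬ R x y) → Tri R (x ∷ L)
fan [] h = small (s≤s z≤n)
fan (y ∷ []) h = small (s≤s (s≤s z≤n))
fan (y ∷ z ∷ L) h = cut (h (there (here refl))) (fan (z ∷ L) (λ i → h (there i)))

Unique-resp-↭ : ∀ {A : Set} {L M : List A} → L ↭ M → Unique L → Unique M
Unique-resp-↭ {A} p = U.Unique-resp-↭ (↭⇒↭ₛ p)
  where
  import Data.List.Relation.Binary.Permutation.Setoid.Properties (setoid A) as U

-- G may stand for F once only the edges inside L matter, so that deleting vertices from L shrinks G.
Sparse : ∀ {n} → EdgeSet n → List (Fin n) → EdgeSet n → Set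
Sparse F L G = Unique L × length G + 3 ≤ length L × (∀ {x y} → x ∈ L → y ∈ L → Adj F x y → Adj G x y)

sparse-↭ : ∀ {n} {F G : EdgeSet n} {L M} → L ↭ M → Sparse F L G → Sparse F M G
sparse-↭ p (u , l , c) =
  Unique-resp-↭ p u , subst (_ ≤_) (↭-length p) l ,
  λ i j → c (∈-resp-↭ (↭-sym p) i) (∈-resp-↭ (↭-sym p) j)

-- Deleting `b` removes at least `c` edges. With `c = 1` sparseness passes to the smaller polygon;
-- with `c = 2` one edge in excess is absorbed as well.
sparse-del : ∀ {n} {F G : EdgeSet n} {b L} c → c ≤ deg G b → Unique (b ∷ L) → length G + 3 ≤ c + length L →
  (∀ {x y} → x ∈ b ∷ L → y ∈ b ∷ L → Adj F x y → Adj G x y) → Sparse F L (del b G)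
sparse-del {F = F} {G} {b} {L} c d (b∉L ∷ u) l cov =
  u , +-cancelˡ-≤ c _ _ shrinks ,
  λ i j r → adj-del G (λ e → All.lookup b∉L i (sym e)) (λ e → All.lookup b∉L j (sym e))
              (cov (there i) (there j) r)
  where
  open ≤-Reasoning
  shrinks : c + (length (del b G) + 3) ≤ c + length L
  shrinks = begin
    c + (length (del b G) + 3)       ≤⟨ +-monoˡ-≤ _ d ⟩
    deg G b + (length (del b G) + 3) ≡⟨ sym (+-assoc (deg G b) _ 3) ⟩
    deg G b + length (del b G) + 3   ≡⟨ cong (_+ 3) (deg+length-del b G) ⟩
    length G + 3                     ≤⟨ l ⟩
    c + length L ∎

last-two : ∀ {A : Set} (x y : A) N → ∃ λ Q → ∃ λ a → ∃ λ b → x ∷ y ∷ N ≡ Q ++ a ∷ b ∷ []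
last-two x y [] = [] , x , y , refl
last-two x y (z ∷ N) with last-two y z N
... | Q , a , b , eq = x ∷ Q , a , b , cong (x ∷_) eq

-- Positive degrees give `m ≤ 2g` and sparseness gives `2g + 6 ≤ 2m`. With this many vertices, those
-- two places before and two places after a given vertex are distinct.
no-isolated⇒6≤length : ∀ {n} {F G : EdgeSet n} {L} → Sparse F L G →
  (∀ {x} → x ∈ L → 1 ≤ deg G x) → 6 ≤ length L
no-isolated⇒6≤length {G = G} {L} (u , l , _) pos = +-cancelˡ-≤ m 6 m (begin
  m + 6             ≤⟨ +-monoˡ-≤ 6 m≤ ⟩
  (g + g) + 6       ≡⟨ solve 1 (λ g → (g :+ g) :+ con 6 := (g :+ con 3) :+ (g :+ con 3)) refl g ⟩
  (g + 3) + (g + 3) ≤⟨ +-mono-≤ l l ⟩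
  m + m ∎)
  where
  open ≤-Reasoning
  open +-*-Solver
  m = length L
  g = length G
  m≤ : m ≤ g + g
  m≤ = ≤-trans (≤-reflexive (sym (*-identityʳ m))) (≤-trans (length*≤sum (deg G) 1 L pos) (sum-deg≤ G u))

sparse-del₁ : ∀ {n} {F G : EdgeSet n} {b L} → 1 ≤ deg G b → Sparse F (b ∷ L) G → Sparse F L (del b G)
sparse-del₁ d (u , l , cov) = sparse-del 1 d u l cov

-- When every degree in G is positive, some vertex u has degree 1, so one of the two ears
-- next to u is cut off by a chord at u outside F, and that ear carries an edge of G.
sparse⇒Tri : ∀ {n} (F : EdgeSet n) k {L} {G} → length L ≤ k → Sparse F L G → Tri (Adj F) L
sparse⇒Tri F zero l≤k s = small (≤-trans l≤k z≤n)
sparse⇒Tri F (suc k) {L} {G} l≤k s with Any.any? (λ v → deg G v ≟ 0) L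
... | yes p with find p
...   | u , u∈L , d≡0 with ∈-∃++ u∈L
...     | A , B , refl = rot A (u ∷ B) (fan (B ++ A) λ i r →
            <⇒≢ (adj⇒1≤deg G (proj₂ (proj₂ s′) (here refl) (there i) r)) (sym d≡0))
  where
  s′ : Sparse F (u ∷ B ++ A) G
  s′ = sparse-↭ (++-comm A (u ∷ B)) s
sparse⇒Tri F (suc k) {L} {G} l≤k s@(uniq , sz , _) | no ¬p
  with low-degree G uniq (<-≤-trans (m<m+n (length G) (s≤s z≤n)) sz)
... | u , u∈L , d≤1 with ∈-∃++ u∈L
...   | A , B , refl = rot A (u ∷ B)
          (go (B ++ A) d≤1 pos s′ (subst (_≤ suc k) (↭-length (++-comm A (u ∷ B))) l≤k)
              (no-isolated⇒6≤length s′ pos))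
  where
  s′ : Sparse F (u ∷ B ++ A) G
  s′ = sparse-↭ (++-comm A (u ∷ B)) s
  pos : ∀ {x} → x ∈ u ∷ B ++ A → 1 ≤ deg G x
  pos i = n≢0⇒n>0 (λ e → ¬p (lose (∈-resp-↭ (++-comm (u ∷ B) A) i) e))
  -- The only neighbour of `u` in `G` is `z`, so the chord from `u` to `z′`, two places before it,
  -- is free and cuts off the ear `y′`.
  cutBefore : ∀ {u y z Q z′ y′} M → M ≡ Q ++ z′ ∷ y′ ∷ [] → Adj F u z → deg G u ≤ 1 →
    (∀ {x} → x ∈ u ∷ y ∷ z ∷ M → 1 ≤ deg G x) → Sparse F (u ∷ y ∷ z ∷ M) G →
    length (u ∷ y ∷ z ∷ M) ≤ suc k → Tri (Adj F) (u ∷ y ∷ z ∷ M)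
  cutBefore {u} {y} {z} {Q} {z′} {y′} _ refl r d pos s@(_ ∷ _ ∷ z∉ ∷ _ , _ , cov) l =
    rot (u ∷ y ∷ z ∷ Q) (z′ ∷ y′ ∷ [])
      (cut ¬r′ (sparse⇒Tri F k (≤-pred (subst (_≤ suc k) (↭-length perm) l))
        (sparse-del₁ (pos (∈-resp-↭ (↭-sym perm) (here refl))) (sparse-↭ perm s))))
    where
    perm : u ∷ y ∷ z ∷ Q ++ z′ ∷ y′ ∷ [] ↭ y′ ∷ z′ ∷ u ∷ y ∷ z ∷ Q
    perm = ↭-trans (++-comm (u ∷ y ∷ z ∷ Q) (z′ ∷ y′ ∷ [])) (↭-swap z′ y′ ↭-refl)
    z′∈ : z′ ∈ Q ++ z′ ∷ y′ ∷ []
    z′∈ = ∈-++⁺ʳ Q (here refl)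
    ¬r′ : ¬ Adj F z′ u
    ¬r′ r′ = <⇒≱ (adj²⇒2≤deg G (cov (here refl) (there (there (here refl))) r)
                     (cov (here refl) (there (there (there z′∈))) (adj-sym {F = F} r′))
                     (All.lookup z∉ z′∈)) d
  go : ∀ {u} M → deg G u ≤ 1 → (∀ {x} → x ∈ u ∷ M → 1 ≤ deg G x) → Sparse F (u ∷ M) G →
       length (u ∷ M) ≤ suc k → 6 ≤ length (u ∷ M) → Tri (Adj F) (u ∷ M)
  go (_ ∷ _ ∷ []) _ _ _ _ (s≤s (s≤s (s≤s ())))
  go (_ ∷ _ ∷ _ ∷ []) _ _ _ _ (s≤s (s≤s (s≤s (s≤s ()))))
  go {u} (y ∷ z ∷ v ∷ w ∷ N) d pos s l _ with adj? F u z | last-two v w N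
  ... | no ¬r | _ = cut ¬r (sparse⇒Tri F k (≤-pred l)
        (sparse-del₁ (pos (there (here refl))) (sparse-↭ (shift y (u ∷ []) _) s)))
  ... | yes r | Q , z′ , y′ , eq = cutBefore _ eq r d pos s l

-- From ear cuttings to sets of non-crossing chords

Cyc : ∀ {n} → Fin n → Fin n → Fin n → Set
Cyc a b c = (toℕ a < toℕ b × toℕ b < toℕ c) ⊎ (toℕ b < toℕ c × toℕ c < toℕ a) ⊎ (toℕ c < toℕ a × toℕ a < toℕ b)

cyc-rot : ∀ {n} {a b c : Fin n} → Cyc a b c → Cyc b c a
cyc-rot (inj₁ p) = inj₂ (inj₂ p)
cyc-rot (inj₂ (inj₁ p)) = inj₁ p
cyc-rot (inj₂ (inj₂ p)) = inj₂ (inj₁ p)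

-- The closed arc from c forward to a.
Arc : ∀ {n} → Fin n → Fin n → Fin n → Set
Arc a c z = z ≡ a ⊎ z ≡ c ⊎ Cyc a c z

between-swap : ∀ {x y z} → Between x y z → Between y x z
between-swap = Sum.swap

outside-swap : ∀ {x y z} → Outside x y z → Outside y x z
outside-swap (inj₁ (p , q)) = inj₁ (q , p)
outside-swap (inj₂ (p , q)) = inj₂ (q , p)

cross-swapˡ : ∀ {n} {a b c d : Fin n} → Cross a b c d → Cross b a c d
cross-swapˡ = Sum.map (λ (p , q) → between-swap p , outside-swap q) (λ (p , q) → between-swap p , outside-swap q)

no-cross-common : ∀ {n} {a b c : Fin n} → ¬ Cross a c b c
no-cross-common (inj₁ (_ , inj₁ (_ , p))) = <-irrefl refl p
no-cross-common (inj₁ (_ , inj₂ (_ , p))) = <-irrefl refl p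
no-cross-common (inj₂ (inj₁ (_ , p) , _)) = <-irrefl refl p
no-cross-common (inj₂ (inj₂ (p , _) , _)) = <-irrefl refl p

-- If `a < c`, no point of the arc lies between the two numbers; if `c < a`, none lies outside them.
arc-one-side : ∀ {n} {a c z w : Fin n} → Arc a c z → Arc a c w →
  ¬ (Between (toℕ a) (toℕ c) (toℕ z) × Outside (toℕ a) (toℕ c) (toℕ w))
arc-one-side (inj₁ refl) _ (inj₁ (p , _) , _) = <-irrefl refl p
arc-one-side (inj₁ refl) _ (inj₂ (_ , p) , _) = <-irrefl refl p
arc-one-side (inj₂ (inj₁ refl)) _ (inj₁ (_ , p) , _) = <-irrefl refl p
arc-one-side (inj₂ (inj₁ refl)) _ (inj₂ (p , _) , _) = <-irrefl refl p
arc-one-side (inj₂ (inj₂ _)) (inj₁ refl) (_ , inj₁ (p , _)) = <-irrefl refl p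
arc-one-side (inj₂ (inj₂ _)) (inj₁ refl) (_ , inj₂ (p , _)) = <-irrefl refl p
arc-one-side (inj₂ (inj₂ _)) (inj₂ (inj₁ refl)) (_ , inj₁ (_ , p)) = <-irrefl refl p
arc-one-side (inj₂ (inj₂ _)) (inj₂ (inj₁ refl)) (_ , inj₂ (_ , p)) = <-irrefl refl p
arc-one-side (inj₂ (inj₂ (inj₁ (_ , c<z)))) _ (inj₁ (_ , z<c) , _) = <-asym c<z z<c
arc-one-side (inj₂ (inj₂ (inj₁ (a<c , _)))) _ (inj₂ (c<z , z<a) , _) = <-asym a<c (<-trans c<z z<a)
arc-one-side (inj₂ (inj₂ (inj₂ (inj₂ (z<a , a<c))))) _ (inj₁ (a<z , _) , _) = <-asym a<z z<a
arc-one-side (inj₂ (inj₂ (inj₂ (inj₂ (z<a , a<c))))) _ (inj₂ (c<z , _) , _) = <-asym a<c (<-trans c<z z<a)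
arc-one-side (inj₂ (inj₂ (inj₂ (inj₁ (c<z , z<a))))) (inj₂ (inj₂ (inj₁ (a<c , _)))) _ = <-asym a<c (<-trans c<z z<a)
arc-one-side (inj₂ (inj₂ (inj₂ (inj₁ (c<z , z<a))))) (inj₂ (inj₂ (inj₂ (inj₂ (_ , a<c))))) _ = <-asym a<c (<-trans c<z z<a)
arc-one-side (inj₂ (inj₂ (inj₂ (inj₁ _)))) (inj₂ (inj₂ (inj₂ (inj₁ (c<w , w<a))))) (_ , inj₁ (_ , w<c)) = <-asym c<w w<c
arc-one-side (inj₂ (inj₂ (inj₂ (inj₁ _)))) (inj₂ (inj₂ (inj₂ (inj₁ (c<w , w<a))))) (_ , inj₂ (a<w , _)) = <-asym a<w w<a

arc-no-cross : ∀ {n} {a c z w : Fin n} → Arc a c z → Arc a c w → ¬ Cross a c z w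
arc-no-cross p q (inj₁ r) = arc-one-side p q r
arc-no-cross p q (inj₂ r) = arc-one-side q p r

-- Any three entries, in list order, go round the boundary in the increasing direction. Unlike
-- sortedness, this survives rotation.
Cyclic : ∀ {n} → List (Fin n) → Set
Cyclic [] = ⊤
Cyclic (x ∷ L) = AllPairs (Cyc x) L × Cyclic L

cyclic-∷ʳ : ∀ {n} {x : Fin n} L → AllPairs (Cyc x) L → Cyclic L → Cyclic (L ++ x ∷ [])
cyclic-∷ʳ [] _ _ = [] , tt
cyclic-∷ʳ (y ∷ L) (p ∷ ps) (qs , c) =
  ++⁺ qs ([] ∷ []) (All.map (λ t → cyc-rot t ∷ []) p) , cyclic-∷ʳ L ps c

cyclic-rot : ∀ {n} (A B : List (Fin n)) → Cyclic (A ++ B) → Cyclic (B ++ A)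
cyclic-rot [] B c = subst Cyclic (sym (++-identityʳ B)) c
cyclic-rot (x ∷ A) B (ps , c) =
  subst Cyclic (++-assoc B (x ∷ []) A)
    (cyclic-rot A (B ++ x ∷ []) (subst Cyclic (++-assoc A B (x ∷ [])) (cyclic-∷ʳ (A ++ B) ps c)))

-- A diagonal of the polygon `L`, given by witnesses strictly on its two sides. This form passes to
-- larger polygons and tells old chords from the chord of a new ear.
Splits : ∀ {n} → List (Fin n) → Edge n → Set
Splits L (x , y) =
  x ∈ L × y ∈ L × (∃ λ p → p ∈ L × Between (toℕ x) (toℕ y) (toℕ p)) ×
  (∃ λ q → q ∈ L × Outside (toℕ x) (toℕ y) (toℕ q))

splits-⊆ : ∀ {n} {L M : List (Fin n)} → (∀ {x} → x ∈ L → x ∈ M) → ∀ {e} → Splits L e → Splits M e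
splits-⊆ f (i , j , (p , k , b) , (q , l , o)) = f i , f j , (p , f k , b) , (q , f l , o)

NonCrossing : ∀ {n} → Edge n → Edge n → Set
NonCrossing e f = ¬ Cross (proj₁ e) (proj₂ e) (proj₁ f) (proj₂ f)

record Dissection {n} (R : Fin n → Fin n → Set) (L : List (Fin n)) : Set where
  constructor dissection
  field
    chords  : EdgeSet n
    splits  : All (Splits L) chords
    avoids  : All (λ e → ¬ R (proj₁ e) (proj₂ e)) chords
    normal  : All Normalised chords
    unique  : Unique chords
    size    : length chords ≡ length L ∸ 3
    planar  : AllPairs NonCrossing chords

-- The ends of each earlier chord are in `L`, which `xy` does not separate, so there is no crossing.
-- Each earlier chord does separate `L`, so it differs from `xy`.
addChord : ∀ {n} {R : Fin n → Fin n → Set} {L M : List (Fin n)} {x y} →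
  (∀ {z} → z ∈ L → z ∈ M) → suc (length L ∸ 3) ≡ length M ∸ 3 →
  (∀ {z w} → z ∈ L → w ∈ L → ¬ (Between (toℕ x) (toℕ y) (toℕ z) × Outside (toℕ x) (toℕ y) (toℕ w))) →
  Splits M (x , y) → ¬ R x y → toℕ x < toℕ y → Dissection R L → Dissection R M
addChord {L = L} {x = x} {y} L⊆M sz one-side sp ¬r x<y D = dissection ((x , y) ∷ chords)
  (sp ∷ All.map (splits-⊆ L⊆M) splits) (¬r ∷ avoids) (x<y ∷ normal)
  (All.map (λ s e → fresh s (sym e)) splits ∷ unique)
  (trans (cong suc size) sz)
  (All.map (λ { (i , j , _) → Sum.[ one-side i j , one-side j i ] }) splits ∷ planar)
  where
  open Dissection D
  fresh : ∀ {e} → Splits L e → e ≢ (x , y)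
  fresh (_ , _ , (_ , i , b) , (_ , j , o)) refl = one-side i j (b , o)

∈-skip : ∀ {A : Set} {x a b : A} {L} → x ∈ a ∷ L → x ∈ a ∷ b ∷ L
∈-skip (here p) = here p
∈-skip (there i) = there (there i)

∈⇒arc : ∀ {n} {a c z : Fin n} {L} → All (Cyc a c) L → z ∈ a ∷ c ∷ L → Arc a c z
∈⇒arc _ (here p) = inj₁ p
∈⇒arc _ (there (here p)) = inj₂ (inj₁ p)
∈⇒arc acs (there (there i)) = inj₂ (inj₂ (All.lookup acs i))

-- The vertices `b` and `d` witness the two sides of `ac`, hence the fourth vertex. The order of `a`
-- and `c` decides how the new chord is normalised.
addEar : ∀ {n} {R : Fin n → Fin n → Set} → (∀ {x y} → R x y → R y x) →
  ∀ {a b c d} {L} → ¬ R a c → Cyclic (a ∷ b ∷ c ∷ d ∷ L) →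
  Dissection R (a ∷ c ∷ d ∷ L) → Dissection R (a ∷ b ∷ c ∷ d ∷ L)
addEar R-sym {a} {b} {c} {d} {L} ¬r ((((abc ∷ _) ∷ (acs ∷ _))) , _) D
  with <-cmp (toℕ a) (toℕ c)
... | tri< a<c _ _ = addChord ∈-skip refl (λ i j → arc-one-side (arc i) (arc j))
      (here refl , there (there (here refl)) ,
       (b , there (here refl) , inner abc) , (d , there (there (there (here refl))) , outer (All.head acs)))
      ¬r a<c D
  where
  arc : ∀ {z} → z ∈ a ∷ c ∷ d ∷ L → Arc a c z
  arc = ∈⇒arc acs
  inner : Cyc a b c → Between (toℕ a) (toℕ c) (toℕ b)
  inner (inj₁ p) = inj₁ p
  inner (inj₂ (inj₁ (_ , c<a))) = contradiction a<c (<-asym c<a)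
  inner (inj₂ (inj₂ (c<a , _))) = contradiction a<c (<-asym c<a)
  outer : ∀ {z} → Cyc a c z → Outside (toℕ a) (toℕ c) (toℕ z)
  outer (inj₁ (p , q)) = inj₂ (<-trans p q , q)
  outer (inj₂ (inj₁ (p , q))) = contradiction a<c (<-asym (<-trans p q))
  outer (inj₂ (inj₂ (p , q))) = inj₁ (p , <-trans p q)
... | tri> _ _ c<a = addChord ∈-skip refl
      (λ i j (b , o) → arc-one-side (arc i) (arc j) (between-swap b , outside-swap o))
      (there (there (here refl)) , here refl ,
       (d , there (there (there (here refl))) , inner (All.head acs)) , (b , there (here refl) , outer abc))
      (λ r → ¬r (R-sym r)) c<a D
  where
  arc : ∀ {z} → z ∈ a ∷ c ∷ d ∷ L → Arc a c z
  arc = ∈⇒arc acs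
  inner : ∀ {z} → Cyc a c z → Between (toℕ c) (toℕ a) (toℕ z)
  inner (inj₁ (p , q)) = contradiction c<a (<-asym p)
  inner (inj₂ (inj₁ p)) = inj₁ p
  inner (inj₂ (inj₂ (p , q))) = contradiction c<a (<-asym q)
  outer : Cyc a b c → Outside (toℕ c) (toℕ a) (toℕ b)
  outer (inj₁ (p , q)) = contradiction c<a (<-asym (<-trans p q))
  outer (inj₂ (inj₁ (p , q))) = inj₁ (p , <-trans p q)
  outer (inj₂ (inj₂ (p , q))) = inj₂ (<-trans p q , q)
... | tri≈ _ a≡c _ = contradiction a≡c (distinct abc)
  where
  distinct : Cyc a b c → toℕ a ≢ toℕ c
  distinct (inj₁ (p , q)) = <⇒≢ (<-trans p q)
  distinct (inj₂ (inj₁ (_ , q))) e = <⇒≢ q (sym e)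
  distinct (inj₂ (inj₂ (p , _))) e = <⇒≢ p (sym e)

Tri⇒Dissection : ∀ {n} {R : Fin n → Fin n → Set} → (∀ {x y} → R x y → R y x) →
  ∀ {L} → Tri R L → Cyclic L → Dissection R L
Tri⇒Dissection _ (small l) _ = dissection [] [] [] [] [] (sym (m≤n⇒m∸n≡0 l)) []
-- A cut in a triangle runs along a side, so it contributes no chord.
Tri⇒Dissection _ (cut {L = []} _ _) _ = dissection [] [] [] [] [] refl []
Tri⇒Dissection R-sym (cut {L = d ∷ L} ¬r t) c@((_ ∷ as) , _ , cs) =
  addEar R-sym ¬r c (Tri⇒Dissection R-sym t (as , cs))
Tri⇒Dissection R-sym (rot A B t) c with Tri⇒Dissection R-sym t (cyclic-rot A B c)
... | dissection ch sp av nm un sz pl =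
  dissection ch (All.map (splits-⊆ (∈-resp-↭ (++-comm B A))) sp) av nm un
    (trans sz (cong (_∸ 3) (↭-length (++-comm B A)))) pl

toℕ-next : ∀ {n} (a : Fin n) → toℕ (next a) ≡ suc (toℕ a) ⊎ (toℕ (next a) ≡ 0 × suc (toℕ a) ≡ n)
toℕ-next {suc n} a with suc (toℕ a) <? suc n
... | yes lt = inj₁ (trans (toℕ-fromℕ< _) (trans (m<n⇒m%n≡m (subst (_< suc n) (+-comm 1 (toℕ a)) lt)) (+-comm (toℕ a) 1)))
... | no ¬lt = inj₂ (trans (toℕ-fromℕ< _) (trans (cong (_% suc n) (trans (+-comm (toℕ a) 1) eq)) (n%n≡0 (suc n))) , eq)
  where
  eq : suc (toℕ a) ≡ suc n
  eq = ≤-antisym (toℕ<n a) (≮⇒≥ ¬lt)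

-- Either the two numbers are consecutive and nothing lies between them, or they are the last one
-- and 0 and nothing lies outside.
next-unsplit : ∀ {n} (a : Fin n) {p q : Fin n} →
  Between (toℕ a) (toℕ (next a)) (toℕ p) → Outside (toℕ a) (toℕ (next a)) (toℕ q) → ⊥
next-unsplit {n} a {p} {q} b o with toℕ (next a) | toℕ-next a
... | _ | inj₁ refl = Sum.[ (λ (l , u) → <⇒≱ l (≤-pred u)) , (λ (l , u) → <-asym l (<-trans u (n<1+n _))) ] b
... | _ | inj₂ (refl , eq) = Sum.[ (λ { (_ , ()) }) , (λ (u , _) → <⇒≱ u (≤-pred (subst (toℕ q <_) (sym eq) (toℕ<n q)))) ] o

splits⇒diagonal : ∀ {n} {L : List (Fin n)} {e} → Splits L e → IsDiagonal e
splits⇒diagonal {e = a , b} (_ , _ , (p , _ , bt) , (q , _ , o)) = a≢b bt , λ where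
    (inj₁ refl) → next-unsplit a bt o
    (inj₂ refl) → next-unsplit b (between-swap bt) (outside-swap o)
  where
  a≢b : Between (toℕ a) (toℕ b) (toℕ p) → a ≢ b
  a≢b (inj₁ (l , u)) refl = <-asym l u
  a≢b (inj₂ (l , u)) refl = <-asym l u

Tri⇒AdmitsTriangulation : ∀ {n} {F : EdgeSet n} {L} → (∀ a b → IsBoundary a b → ¬ Adj F a b) →
  Cyclic L → length L ≡ n → Tri (Adj F) L → AdmitsTriangulation n F
Tri⇒AdmitsTriangulation {F = F} ∂∉F c l t =
  (λ i → ∂∉F i (next i) (inj₁ refl)) ,
  chords , (normal , unique) , All.map splits⇒diagonal splits , avoids ,
  trans size (cong (_∸ 3) l) , planar
  where open Dissection (Tri⇒Dissection (adj-sym {F = F}) t c)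

-- Decidability of having a triangulation

∃-list? : ∀ {n} {P : EdgeSet n → Set} k → (∀ D → Dec (P D)) → Dec (∃ λ D → length D ≡ k × P D)
∃-list? zero P? = map′ (λ p → [] , refl , p) (λ { ([] , _ , p) → p }) (P? [])
∃-list? (suc k) P? =
  map′ (λ { (a , b , D , l , p) → (a , b) ∷ D , cong suc l , p })
       (λ { ((a , b) ∷ D , l , p) → a , b , D , suc-injective l , p })
       (any? λ a → any? λ b → ∃-list? k λ D → P? ((a , b) ∷ D))

-- The number of chords is fixed, so the search is finite. Decidability makes the final proof by
-- contradiction constructive.
admitsTriangulation? : ∀ n F → Dec (AdmitsTriangulation n F)
admitsTriangulation? n F =
  all? (λ i → ¬? (adj? F i (next i))) ×-dec
  map′ (λ { (D , l , w , d , a , p) → D , w , d , a , l , p })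
       (λ { (D , w , d , a , l , p) → D , l , w , d , a , p })
       (∃-list? (n ∸ 3) λ D →
         (All.all? (λ e → toℕ (proj₁ e) <? toℕ (proj₂ e)) D ×-dec
          AllPairs.allPairs? (λ e f → ¬? (≡-dec _≟ᶠ_ _≟ᶠ_ e f)) D) ×-dec
         All.all? (λ e → ¬? (proj₁ e ≟ᶠ proj₂ e) ×-dec
           ¬? ((proj₂ e ≟ᶠ next (proj₁ e)) ⊎-dec (proj₁ e ≟ᶠ next (proj₂ e)))) D ×-dec
         All.all? (λ e → ¬? (adj? F (proj₁ e) (proj₂ e))) D ×-dec
         AllPairs.allPairs? (λ e f → ¬? (cross? (proj₁ e) (proj₂ e) (proj₁ f) (proj₂ f))) D)
  where
  between? : ∀ x y z → Dec (Between x y z)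
  between? x y z = ((x <? z) ×-dec (z <? y)) ⊎-dec ((y <? z) ×-dec (z <? x))
  outside? : ∀ x y z → Dec (Outside x y z)
  outside? x y z = ((z <? x) ×-dec (z <? y)) ⊎-dec ((x <? z) ×-dec (y <? z))
  cross? : ∀ a b c d → Dec (Cross {n} a b c d)
  cross? a b c d =
    (between? _ _ _ ×-dec outside? _ _ _) ⊎-dec (between? _ _ _ ×-dec outside? _ _ _)

-- Polygons as intervals of indices

range : ∀ {V : Set} → (ℕ → V) → ℕ → ℕ → List V
range f i zero = []
range f i (suc d) = f i ∷ range f (suc i) d

length-range : ∀ {V : Set} (f : ℕ → V) i d → length (range f i d) ≡ d
length-range f i zero = refl
length-range f i (suc d) = cong suc (length-range f (suc i) d)

range-++ : ∀ {V : Set} (f : ℕ → V) i d e → range f i (d + e) ≡ range f i d ++ range f (i + d) e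
range-++ f i zero e = cong (λ j → range f j e) (sym (+-identityʳ i))
range-++ f i (suc d) e = cong (f i ∷_) (trans (range-++ f (suc i) d e)
  (cong (λ j → range f (suc i) d ++ range f j e) (sym (+-suc i d))))

range-all : ∀ {V : Set} {P : V → Set} (f : ℕ → V) i d →
  (∀ {j} → i ≤ j → j < i + d → P (f j)) → All P (range f i d)
range-all f i zero h = []
range-all f i (suc d) h =
  h ≤-refl (m<m+n i (s≤s z≤n)) ∷
  range-all f (suc i) d (λ {j} l u → h (<⇒≤ l) (subst (j <_) (sym (+-suc i d)) u))

range-allPairs : ∀ {V : Set} {P : V → V → Set} (f : ℕ → V) i d →
  (∀ {j k} → i ≤ j → j < k → k < i + d → P (f j) (f k)) → AllPairs P (range f i d)
range-allPairs f i zero h = []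
range-allPairs f i (suc d) h =
  range-all f (suc i) d (λ {j} l u → h ≤-refl l (subst (j <_) (sym (+-suc i d)) u)) ∷
  range-allPairs f (suc i) d (λ {_} {k} l m u → h (<⇒≤ l) m (subst (k <_) (sym (+-suc i d)) u))

range-cyclic : ∀ {n} (f : ℕ → Fin n) i d →
  (∀ {j k l} → i ≤ j → j < k → k < l → l < i + d → Cyc (f j) (f k) (f l)) → Cyclic (range f i d)
range-cyclic f i zero h = tt
range-cyclic f i (suc d) h =
  range-allPairs f (suc i) d (λ {_} {k} l m u → h ≤-refl l m (subst (k <_) (sym (+-suc i d)) u)) ,
  range-cyclic f (suc i) d (λ {_} {_} {l} p q r u → h (<⇒≤ p) q r (subst (l <_) (sym (+-suc i d)) u))

-- A triangulation of the polygon f i, …, f j as a binary tree whose root is the side f i f j.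
data Span {V : Set} (R : V → V → Set) (f : ℕ → V) : ℕ → ℕ → Set where
  side : ∀ {i} → Span R f i (suc i)
  apex : ∀ {i k j} → ¬ R (f i) (f j) → Span R f i k → Span R f k j → Span R f i j

module _ {V : Set} {R : V → V → Set} {f : ℕ → V} where

  cut-in : ∀ A {a b c B} → ¬ R a c → Tri R (A ++ a ∷ c ∷ B) → Tri R (A ++ a ∷ b ∷ c ∷ B)
  cut-in A {a} {b} {c} {B} ¬r t = rot A (a ∷ b ∷ c ∷ B) (cut ¬r (rot (a ∷ c ∷ B) A t))

  span-< : ∀ {i j} → Span R f i j → i < j
  span-< side = ≤-refl
  span-< (apex _ s t) = <-trans (span-< s) (span-< t)

  range-split : ∀ {i k j} → i ≤ k → k ≤ j →
    range f i (j ∸ i) ≡ range f i (k ∸ i) ++ range f k (j ∸ k)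
  range-split {i} {k} {j} i≤k k≤j = begin
    range f i (j ∸ i)                                     ≡⟨ cong (range f i) eq ⟩
    range f i ((k ∸ i) + (j ∸ k))                         ≡⟨ range-++ f i (k ∸ i) (j ∸ k) ⟩
    range f i (k ∸ i) ++ range f (i + (k ∸ i)) (j ∸ k)    ≡⟨ cong (λ l → range f i (k ∸ i) ++ range f l (j ∸ k)) (m+[n∸m]≡n i≤k) ⟩
    range f i (k ∸ i) ++ range f k (j ∸ k) ∎
    where
    open ≡-Reasoning
    eq : j ∸ i ≡ (k ∸ i) + (j ∸ k)
    eq = begin
      j ∸ i               ≡⟨ cong (_∸ i) (sym (m+[n∸m]≡n k≤j)) ⟩
      (k + (j ∸ k)) ∸ i   ≡⟨ +-∸-comm (j ∸ k) i≤k ⟩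
      (k ∸ i) + (j ∸ k) ∎

  -- The tree unfolds from its root: each apex inserts an ear between two neighbouring vertices of
  -- the surrounding polygon, and the subtrees refine the two new sides.
  span-expand : ∀ {i j} → Span R f i j → ∀ A B →
    Tri R (A ++ f i ∷ f j ∷ B) → Tri R (A ++ range f i (j ∸ i) ++ f j ∷ B)
  span-expand {i} side A B t rewrite m+n∸n≡m 1 i = t
  span-expand (apex {i} {k} {j} ¬r s t) A B tr =
    subst (Tri R) eq (span-expand t (A ++ range f i (k ∸ i)) B
      (subst (Tri R) (sym (++-assoc A _ _)) (span-expand s A (f j ∷ B) (cut-in A ¬r tr))))
    where
    eq : (A ++ range f i (k ∸ i)) ++ range f k (j ∸ k) ++ f j ∷ B ≡ A ++ range f i (j ∸ i) ++ f j ∷ B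
    eq = trans (++-assoc A _ _) (cong (A ++_) (trans (sym (++-assoc (range f i (k ∸ i)) _ _))
           (cong (_++ f j ∷ B) (sym (range-split (<⇒≤ (span-< s)) (<⇒≤ (span-< t)))))))

  span⇒Tri : ∀ {N} → Span R f 0 N → Tri R (range f 0 (suc N))
  span⇒Tri {N} s = subst (Tri R) eq (span-expand s [] [] (small (s≤s (s≤s z≤n))))
    where
    eq : range f 0 N ++ f N ∷ [] ≡ range f 0 (suc N)
    eq = trans (sym (range-++ f 0 N 1)) (cong (range f 0) (+-comm N 1))

  span-extend : ∀ {i j} k → Span R f i j → j ≤ k → (∀ {z} → j < z → z ≤ k → ¬ R (f i) (f z)) → Span R f i k
  span-extend {i} {j} k s j≤k h with m≤n⇒m<n∨m≡n j≤k
  ... | inj₂ refl = s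
  span-extend (suc k) s j≤k h | inj₁ (s≤s j≤k′) =
    apex (h (s≤s j≤k′) ≤-refl) (span-extend k s j≤k′ (λ l u → h l (m≤n⇒m≤1+n u))) side

  fan-up : ∀ {i k} → i < k → (∀ {z} → suc i < z → z ≤ k → ¬ R (f i) (f z)) → Span R f i k
  fan-up {k = k} i<k h = span-extend k side i<k h

  fan-down : ∀ {i k} → i < k → (∀ {z} → i ≤ z → suc z < k → ¬ R (f z) (f k)) → Span R f i k
  fan-down {i} {k} i<k h = go (k ∸ suc i) i h (sym (m+[n∸m]≡n i<k))
    where
    go : ∀ d i → (∀ {z} → i ≤ z → suc z < k → ¬ R (f z) (f k)) → k ≡ suc i + d → Span R f i k
    go zero i h eq rewrite trans eq (+-identityʳ (suc i)) = side
    go (suc d) i h eq =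
      apex (h ≤-refl (subst (suc i <_) (sym eq) (m<m+n (suc i) (s≤s z≤n))))
           side (go d (suc i) (λ l u → h (<⇒≤ l) u) (trans eq (+-suc (suc i) d)))

  -- Chords from f 0 triangulate everything outside f x, …, f y.
  fan-around : ∀ {x y N} → 1 ≤ x → Span R f x y → y ≤ N →
    (∀ {z} → 1 ≤ z → z ≤ N → z ≤ x ⊎ y ≤ z → ¬ R (f 0) (f z)) → Span R f 0 N
  fan-around {x} {y} {N} 1≤x s y≤N h =
    span-extend N
      (apex (h (<-trans 1≤x x<y) y≤N (inj₂ ≤-refl))
        (fan-up 1≤x (λ l u → h (<⇒≤ l) (≤-trans u (≤-trans (<⇒≤ x<y) y≤N)) (inj₁ u))) s)
      y≤N (λ l u → h (≤-trans (<⇒≤ (≤-<-trans 1≤x x<y)) (<⇒≤ l)) u (inj₂ (<⇒≤ l)))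
    where x<y = span-< s

-- Labelling the boundary from a base vertex

module _ {N : ℕ} where

  private
    V : Set
    V = Fin (suc N)
    v : V → ℕ → V
    v s i = vtx s true i

  toℕ-vtx : ∀ (s : V) i → toℕ (v s i) ≡ (toℕ s + i) % suc N
  toℕ-vtx s i = toℕ-fromℕ< _

  vtx-0 : ∀ (s : V) → v s 0 ≡ s
  vtx-0 s = toℕ-injective (trans (toℕ-vtx s 0)
    (trans (cong (_% suc N) (+-identityʳ (toℕ s))) (m<n⇒m%n≡m (toℕ<n s))))

  [m%d+n]%d : ∀ m n → (m % suc N + n) % suc N ≡ (m + n) % suc N
  [m%d+n]%d m n = begin
    (m % suc N + n) % suc N                   ≡⟨ %-distribˡ-+ (m % suc N) n (suc N) ⟩
    (m % suc N % suc N + n % suc N) % suc N   ≡⟨ cong (λ t → (t + n % suc N) % suc N) (m%n%n≡m%n m (suc N)) ⟩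
    (m % suc N + n % suc N) % suc N           ≡⟨ sym (%-distribˡ-+ m n (suc N)) ⟩
    (m + n) % suc N ∎
    where open ≡-Reasoning

  vtx-+ : ∀ (s : V) i j → v (v s i) j ≡ v s (i + j)
  vtx-+ s i j = toℕ-injective (begin
    toℕ (v (v s i) j)                   ≡⟨ toℕ-vtx (v s i) j ⟩
    (toℕ (v s i) + j) % suc N           ≡⟨ cong (λ t → (t + j) % suc N) (toℕ-vtx s i) ⟩
    ((toℕ s + i) % suc N + j) % suc N   ≡⟨ [m%d+n]%d (toℕ s + i) j ⟩
    (toℕ s + i + j) % suc N             ≡⟨ cong (_% suc N) (+-assoc (toℕ s) i j) ⟩
    (toℕ s + (i + j)) % suc N           ≡⟨ sym (toℕ-vtx s (i + j)) ⟩
    toℕ (v s (i + j)) ∎)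
    where open ≡-Reasoning

  vtx-period : ∀ (s : V) i → v s (i + suc N) ≡ v s i
  vtx-period s i = toℕ-injective (begin
    toℕ (v s (i + suc N))           ≡⟨ toℕ-vtx s _ ⟩
    (toℕ s + (i + suc N)) % suc N   ≡⟨ cong (_% suc N) (sym (+-assoc (toℕ s) i (suc N))) ⟩
    (toℕ s + i + suc N) % suc N     ≡⟨ [m+n]%n≡m%n (toℕ s + i) (suc N) ⟩
    (toℕ s + i) % suc N             ≡⟨ sym (toℕ-vtx s i) ⟩
    toℕ (v s i) ∎)
    where open ≡-Reasoning

  -- The inverse of `v s` on labels up to `N`; `suc N ∸ toℕ s` stands for `- toℕ s` modulo `suc N`.
  index : V → V → ℕ
  index s x = (toℕ x + (suc N ∸ toℕ s)) % suc N

  index< : ∀ s x → index s x < suc N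
  index< s x = m%n<n (toℕ x + (suc N ∸ toℕ s)) (suc N)

  vtx-index : ∀ s x → v s (index s x) ≡ x
  vtx-index s x = toℕ-injective (begin
    toℕ (v s (index s x))                              ≡⟨ toℕ-vtx s _ ⟩
    (toℕ s + index s x) % suc N                        ≡⟨ cong (_% suc N) (+-comm (toℕ s) (index s x)) ⟩
    (index s x + toℕ s) % suc N                        ≡⟨ [m%d+n]%d (toℕ x + (suc N ∸ toℕ s)) (toℕ s) ⟩
    (toℕ x + (suc N ∸ toℕ s) + toℕ s) % suc N          ≡⟨ cong (_% suc N) (+-assoc (toℕ x) _ _) ⟩
    (toℕ x + ((suc N ∸ toℕ s) + toℕ s)) % suc N        ≡⟨ cong (λ t → (toℕ x + t) % suc N) (m∸n+n≡m (<⇒≤ (toℕ<n s))) ⟩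
    (toℕ x + suc N) % suc N                            ≡⟨ [m+n]%n≡m%n (toℕ x) (suc N) ⟩
    toℕ x % suc N                                      ≡⟨ m<n⇒m%n≡m (toℕ<n x) ⟩
    toℕ x ∎)
    where open ≡-Reasoning

  index-vtx : ∀ s {i} → i < suc N → index s (v s i) ≡ i
  index-vtx s {i} i<n = begin
    (toℕ (v s i) + (suc N ∸ toℕ s)) % suc N             ≡⟨ cong (λ t → (t + (suc N ∸ toℕ s)) % suc N) (toℕ-vtx s i) ⟩
    ((toℕ s + i) % suc N + (suc N ∸ toℕ s)) % suc N     ≡⟨ [m%d+n]%d (toℕ s + i) _ ⟩
    (toℕ s + i + (suc N ∸ toℕ s)) % suc N               ≡⟨ cong (λ t → (t + (suc N ∸ toℕ s)) % suc N) (+-comm (toℕ s) i) ⟩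
    (i + toℕ s + (suc N ∸ toℕ s)) % suc N               ≡⟨ cong (_% suc N) (+-assoc i (toℕ s) _) ⟩
    (i + (toℕ s + (suc N ∸ toℕ s))) % suc N             ≡⟨ cong (λ t → (i + t) % suc N) (m+[n∸m]≡n (<⇒≤ (toℕ<n s))) ⟩
    (i + suc N) % suc N                                 ≡⟨ [m+n]%n≡m%n i (suc N) ⟩
    i % suc N                                           ≡⟨ m<n⇒m%n≡m i<n ⟩
    i ∎
    where open ≡-Reasoning

  vtx-injective : ∀ s {i j} → i < suc N → j < suc N → v s i ≡ v s j → i ≡ j
  vtx-injective s i<n j<n eq = trans (sym (index-vtx s i<n)) (trans (cong (index s) eq) (index-vtx s j<n))

  toℕ-vtx-wrap : ∀ (s : V) i → suc N ≤ toℕ s + i → i < suc N → suc N + toℕ (v s i) ≡ toℕ s + i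
  toℕ-vtx-wrap s i wrap i<n = begin
    suc N + toℕ (v s i)               ≡⟨ cong (suc N +_) (toℕ-vtx s i) ⟩
    suc N + (toℕ s + i) % suc N       ≡⟨ cong (λ t → suc N + t % suc N) (sym eq) ⟩
    suc N + (r + suc N) % suc N       ≡⟨ cong (suc N +_) ([m+n]%n≡m%n r (suc N)) ⟩
    suc N + r % suc N                 ≡⟨ cong (suc N +_) (m<n⇒m%n≡m r<n) ⟩
    suc N + r                         ≡⟨ +-comm (suc N) r ⟩
    r + suc N                         ≡⟨ eq ⟩
    toℕ s + i ∎
    where
    open ≡-Reasoning
    r = toℕ s + i ∸ suc N
    eq : r + suc N ≡ toℕ s + i
    eq = m∸n+n≡m wrap
    r<n : r < suc N
    r<n = +-cancelʳ-< (suc N) r (suc N) (subst (_< suc N + suc N) (sym eq) (+-mono-< (toℕ<n s) i<n))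

  vtx-mono-unwrapped : ∀ (s : V) {i j} → ¬ suc N ≤ toℕ s + j → i < j → toℕ (v s i) < toℕ (v s j)
  vtx-mono-unwrapped s {i} {j} q l = subst₂ _<_
    (sym (trans (toℕ-vtx s i) (m<n⇒m%n≡m (<-trans (+-monoʳ-< (toℕ s) l) (≰⇒> q)))))
    (sym (trans (toℕ-vtx s j) (m<n⇒m%n≡m (≰⇒> q)))) (+-monoʳ-< (toℕ s) l)

  vtx-mono-wrapped : ∀ (s : V) {i j} → suc N ≤ toℕ s + i → i < j → j < suc N → toℕ (v s i) < toℕ (v s j)
  vtx-mono-wrapped s {i} {j} w l j<n = +-cancelˡ-< (suc N) _ _
    (subst₂ _<_ (sym (toℕ-vtx-wrap s i w (<-trans l j<n)))
      (sym (toℕ-vtx-wrap s j (≤-trans w (<⇒≤ (+-monoʳ-< (toℕ s) l))) j<n)) (+-monoʳ-< (toℕ s) l))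

  vtx-wrap-< : ∀ (s : V) {i j} → ¬ suc N ≤ toℕ s + i → suc N ≤ toℕ s + j → j < suc N →
    toℕ (v s j) < toℕ (v s i)
  vtx-wrap-< s {i} {j} a b j<n = +-cancelˡ-< (suc N) _ _ (begin-strict
    suc N + toℕ (v s j)   ≡⟨ toℕ-vtx-wrap s j b j<n ⟩
    toℕ s + j             <⟨ +-monoʳ-< (toℕ s) j<n ⟩
    toℕ s + suc N         ≡⟨ +-comm (toℕ s) (suc N) ⟩
    suc N + toℕ s         ≤⟨ +-monoʳ-≤ (suc N) (m≤m+n (toℕ s) i) ⟩
    suc N + (toℕ s + i)   ≡⟨ cong (suc N +_) (sym (trans (toℕ-vtx s i) (m<n⇒m%n≡m (≰⇒> a)))) ⟩
    suc N + toℕ (v s i) ∎)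
    where open ≤-Reasoning

  -- The cases record which label, if any, is the first to wrap around; each yields one rotation of
  -- the increasing order.
  cyc-vtx : ∀ (s : V) {i j k} → i < j → j < k → k < suc N → Cyc (v s i) (v s j) (v s k)
  cyc-vtx s {i} {j} {k} i<j j<k k<n with suc N ≤? toℕ s + i | suc N ≤? toℕ s + j | suc N ≤? toℕ s + k
  ... | yes a | _ | _ = inj₁ (vtx-mono-wrapped s a i<j (<-trans j<k k<n) ,
        vtx-mono-wrapped s (≤-trans a (<⇒≤ (+-monoʳ-< (toℕ s) i<j))) j<k k<n)
  ... | no a | yes b | _ = inj₂ (inj₁ (vtx-mono-wrapped s b j<k k<n ,
        vtx-wrap-< s a (≤-trans b (<⇒≤ (+-monoʳ-< (toℕ s) j<k))) k<n))
  ... | no a | no b | yes c = inj₂ (inj₂ (vtx-wrap-< s a c k<n , vtx-mono-unwrapped s b i<j))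
  ... | no a | no b | no c = inj₁ (vtx-mono-unwrapped s b i<j , vtx-mono-unwrapped s c j<k)

  polygon : V → List V
  polygon s = range (v s) 0 (suc N)

  polygon-unique : ∀ s → Unique (polygon s)
  polygon-unique s = range-allPairs (v s) 0 (suc N)
    (λ _ j<k k<n eq → <⇒≢ j<k (vtx-injective s (<-trans j<k k<n) k<n eq))

  polygon-cyclic : ∀ s → Cyclic (polygon s)
  polygon-cyclic s = range-cyclic (v s) 0 (suc N) (λ _ → cyc-vtx s)

least : ∀ {P : ℕ → Set} → (∀ i → Dec (P i)) → ∀ m → P m → ∃ λ k → k ≤ m × P k × (∀ {i} → i < k → ¬ P i)
least P? zero p = 0 , z≤n , p , λ ()
least P? (suc m) p with P? 0
... | yes q = 0 , z≤n , q , λ ()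
... | no ¬q with least (λ i → P? (suc i)) m p
...   | k , k≤m , q , h = suc k , s≤s k≤m , q , λ { {zero} _ → ¬q ; {suc i} (s≤s l) → h l }

-- Graphs blocking every triangulation

module Blocking {M : ℕ} (F : EdgeSet (6 + M)) (wf : WellFormed F) (F≤ : length F ≤ 4 + M)
  (∂∉F : ∀ (a b : Fin (6 + M)) → IsBoundary a b → ¬ Adj F a b)
  (blocked : ¬ AdmitsTriangulation (6 + M) F) (¬config : ¬ HasConfigStar (6 + M) F) where

  private
    -- There are `6 + M` vertices, so `N` is the last label and the bound n - 2 on the number of
    -- edges is `4 + M`.
    N : ℕ
    N = 5 + M
    V : Set
    V = Fin (suc N)
    v : V → ℕ → V
    v s i = vtx s true i
    R : V → V → Set
    R = Adj F

  R-sym : ∀ {x y} → R x y → R y x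
  R-sym = adj-sym {F = F}

  R-subst : ∀ {x x′ y y′} → x ≡ x′ → y ≡ y′ → R x y → R x′ y′
  R-subst refl refl r = r

  R-irrefl : ∀ {x} → ¬ R x x
  R-irrefl (inj₁ i) = <-irrefl refl (All.lookup (proj₁ wf) i)
  R-irrefl (inj₂ i) = <-irrefl refl (All.lookup (proj₁ wf) i)

  vtx-suc : ∀ s i → next (v s i) ≡ v s (suc i)
  vtx-suc s i = trans (vtx-+ s i 1) (cong (v s) (+-comm i 1))

  vtx-n : ∀ s → v s (suc N) ≡ s
  vtx-n s = trans (vtx-period s 0) (vtx-0 s)

  vtx-pred : ∀ s i → v (v s (suc i)) N ≡ v s i
  vtx-pred s i = trans (vtx-+ s (suc i) N) (trans (cong (v s) (sym (+-suc i N))) (vtx-period s i))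

  R-next : ∀ s i → ¬ R (v s i) (v s (suc i))
  R-next s i = ∂∉F _ _ (inj₁ (sym (vtx-suc s i)))

  R-last : ∀ s → ¬ R s (v s N)
  R-last s = ∂∉F _ _ (inj₂ (sym (trans (vtx-suc s N) (vtx-n s))))

  R-first : ∀ s → ¬ R s (v s 1)
  R-first s = ∂∉F _ _ (inj₁ refl)

  no-Tri : ∀ s → ¬ Tri R (polygon s)
  no-Tri s t = blocked (Tri⇒AdmitsTriangulation ∂∉F (polygon-cyclic s) (length-range (v s) 0 (suc N)) t)

  -- The common form of the contradictions below: a triangulated part from `v s x` to `v s y` is
  -- completed by a fan from `s`.
  no-span : ∀ s {x y} → 1 ≤ x → Span R (v s) x y → y ≤ N →
    ¬ (∀ {z} → 1 ≤ z → z ≤ N → z ≤ x ⊎ y ≤ z → ¬ R s (v s z))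
  no-span s 1≤x t y≤N h = no-Tri s (span⇒Tri (fan-around 1≤x t y≤N
    (λ l u o r → h l u o (R-subst (vtx-0 s) refl r))))

  s₀ : V
  s₀ = Data.Fin.zero

  neighbour : ∀ x → ∃ λ y → R x y
  neighbour x with any? (adj? F x)
  ... | yes p = p
  ... | no ¬p = contradiction (λ {z} _ _ _ r → ¬p (v x z , r))
                  -- The part from label 1 to label 2 is a mere side, so the triangulation is the
                  -- full fan of `x`.
                  (no-span x {1} {2} ≤-refl side (s≤s (s≤s z≤n)))

  1≤deg : ∀ x → 1 ≤ deg F x
  1≤deg x = adj⇒1≤deg F (proj₂ (neighbour x))

  size : length F ≡ 4 + M
  size with m≤n⇒m<n∨m≡n F≤
  ... | inj₂ eq = eq
  ... | inj₁ lt = contradiction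
        (sparse⇒Tri F _ ≤-refl (polygon-unique s₀ ,
          subst (length F + 3 ≤_) (sym (length-range (v s₀) 0 (suc N)))
            (subst (length F + 3 ≤_) (+-comm (3 + M) 3) (+-monoˡ-≤ 3 (≤-pred lt))) , λ _ _ r → r))
        (no-Tri s₀)

  -- Pendant vertices and ear chords

  Pendant : V → Set
  Pendant x = deg F x ≡ 1

  pendant? : ∀ x → Dec (Pendant x)
  pendant? x = deg F x ≟ 1

  ¬pendant⇒2≤deg : ∀ {x} → ¬ Pendant x → 2 ≤ deg F x
  ¬pendant⇒2≤deg {x} ¬p = ≤∧≢⇒< (1≤deg x) (λ e → ¬p (sym e))

  2≤deg⇒¬pendant : ∀ {x} → 2 ≤ deg F x → ¬ Pendant x
  2≤deg⇒¬pendant d p = <⇒≢ d (sym p)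

  pendant-unique : ∀ {x y z} → Pendant x → R x y → R x z → y ≡ z
  pendant-unique {x} {y} {z} p r r′ with y ≟ᶠ z
  ... | yes eq = eq
  ... | no ne = contradiction p (2≤deg⇒¬pendant (adj²⇒2≤deg F r r′ ne))

  pendant-only : ∀ {x} s {b c} → Pendant x → R x (v s b) → b ≤ N → c ≤ N → c ≢ b → ¬ R x (v s c)
  pendant-only s p r b≤ c≤ c≢b r′ = c≢b (vtx-injective s (s≤s c≤) (s≤s b≤) (pendant-unique p r′ r))

  low-degree-vertex : ∀ G → length G < suc N → ∃ λ x → deg G x ≤ 1
  low-degree-vertex G l = Product.map₂ proj₂ (low-degree G (polygon-unique s₀)
    (subst (length G <_) (sym (length-range (v s₀) 0 (suc N))) l))

  -- Cutting off v s (1 + i) would leave an (n - 1)-gon with at most n - 4 edges of F.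
  ear : ∀ s i → ¬ Pendant (v s (suc i)) → R (v s i) (v s (2 + i))
  ear s i ¬p with adj? F (v s i) (v s (2 + i))
  ... | yes r = r
  ... | no ¬r = contradiction
        (cut ¬r′ (sparse⇒Tri F _ ≤-refl
          (sparse-del 2 (¬pendant⇒2≤deg ¬p′) (swapped (polygon-unique t))
             (subst₂ _≤_ (cong (_+ 3) (sym size)) (cong (4 +_) (sym (length-range (v t) 3 (3 + M))))
               (≤-reflexive (+-comm (4 + M) 3)))
             (λ _ _ r → r))))
        (no-Tri t)
    where
    t = v s i
    ¬r′ : ¬ R (v t 0) (v t 2)
    ¬r′ r = ¬r (R-subst (vtx-0 t) (trans (vtx-+ s i 2) (cong (v s) (+-comm i 2))) r)
    ¬p′ : ¬ Pendant (v t 1)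
    ¬p′ p = ¬p (subst Pendant (vtx-suc s i) p)
    swapped : ∀ {a b : V} {L} → Unique (a ∷ b ∷ L) → Unique (b ∷ a ∷ L)
    swapped = Unique-resp-↭ (↭-swap _ _ ↭-refl)

  -- Two adjacent pendant vertices u and w = v u j: across the chord uw every x and y are adjacent,
  -- since otherwise xy together with fans from u and w is a triangulation.
  pendant-edge-across : ∀ {u j} → Pendant u → Pendant (v u j) → R u (v u j) → j ≤ N →
    ∀ {x y} → 1 ≤ x → x < j → j < y → y ≤ N → R (v u x) (v u y)
  pendant-edge-across {u} {j} pu pw r j≤N {x} {y} 1≤x x<j j<y y≤N with adj? F (v u x) (v u y)
  ... | yes r′ = r′
  ... | no ¬r = contradiction
        (λ {z} 1≤z z≤N o → pendant-only u pu r j≤N z≤N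
          (λ { refl → Sum.[ (λ l → <⇒≱ x<j l) , (λ l → <⇒≱ j<y l) ] o }))
        (no-span u 1≤x
          (apex ¬r
            (fan-down x<j (λ x≤z z<j r′ → w-only (≤-trans 1≤x x≤z) (≤-trans (<⇒≤ (<⇒≤ z<j)) j≤N) (R-sym r′)))
            (fan-up j<y (λ j<z z≤y → w-only (≤-trans (s≤s z≤n) j<z) (≤-trans z≤y y≤N))))
          y≤N)
    where
    w-only : ∀ {z} → 1 ≤ z → z ≤ N → ¬ R (v u j) (v u z)
    w-only 1≤z z≤N = pendant-only u pw (R-subst refl (sym (vtx-0 u)) (R-sym r)) z≤n z≤N (λ { refl → <⇒≱ 1≤z z≤n })

  -- The hub of the star is `m`. Going round from `v m 1`, a first non-pendant vertex before `v m N`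
  -- would force an ear chord at its predecessor, a pendant vertex already joined to another vertex;
  -- so `F` has no edges beyond those of configuration (a).
  module ConfigurationA {m : V} (p₁ : Pendant (v m 1)) (pN : Pendant (v m N)) (r : R (v m 1) (v m N))
    (star : ∀ {i} → 2 ≤ i → i < N → R m (v m i)) where

    pendants : ∀ i → i < 4 + M → Pendant (v m (suc i))
    pendants zero _ = p₁
    pendants (suc i) l with pendant? (v m (2 + i))
    ... | yes p = p
    ... | no ¬p = contradiction (ear m (suc i) ¬p) (not-ear i l)
      where
      not-ear : ∀ i → suc i < 4 + M → ¬ R (v m (suc i)) (v m (3 + i))
      not-ear zero l = pendant-only m p₁ r ≤-refl (s≤s (s≤s (s≤s z≤n))) (λ ())
      not-ear (suc i) l = pendant-only m (pendants (suc i) (<⇒≤ l))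
        (R-subst refl (sym (vtx-0 m)) (R-sym (star (s≤s (s≤s z≤n)) (s≤s (<⇒≤ l)))))
        z≤n (s≤s l) (λ ())

    adjacent⇒listed : ∀ i x y → i ≤ N → v m i ≡ x → R x y →
      (Σ ℕ λ i → 2 ≤ i × i ≤ 4 + M × SameEdge x y (v m 0) (v m i)) ⊎ SameEdge x y (v m 1) (v m N)
    adjacent⇒listed zero _ y _ refl r′ with index m y | vtx-index m y | index< m y
    ... | zero | refl | _ = ⊥-elim (R-irrefl r′)
    ... | suc zero | refl | _ = ⊥-elim (R-next m 0 r′)
    ... | suc (suc j) | refl | s≤s l with m≤n⇒m<n∨m≡n l
    ...   | inj₁ l′ = inj₁ (suc (suc j) , s≤s (s≤s z≤n) , ≤-pred l′ , inj₁ (refl , refl))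
    ...   | inj₂ refl = ⊥-elim (R-last m (R-subst (vtx-0 m) refl r′))
    adjacent⇒listed (suc zero) _ y _ refl r′ = inj₂ (inj₁ (refl , pendant-unique p₁ r′ r))
    adjacent⇒listed (suc (suc i)) _ y l refl r′ with m≤n⇒m<n∨m≡n l
    ... | inj₂ refl = inj₂ (inj₂ (refl , pendant-unique pN r′ (R-sym r)))
    ... | inj₁ l′ = inj₁ (suc (suc i) , s≤s (s≤s z≤n) , ≤-pred l′ ,
          inj₂ (refl , trans (pendant-unique (pendants (suc i) (≤-pred l′)) r′ (R-sym (star (s≤s (s≤s z≤n)) l′))) (sym (vtx-0 m))))

    listed⇒adjacent : ∀ x y →
      (Σ ℕ λ i → 2 ≤ i × i ≤ 4 + M × SameEdge x y (v m 0) (v m i)) ⊎ SameEdge x y (v m 1) (v m N) → R x y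
    listed⇒adjacent x y (inj₁ (i , l , u , inj₁ (refl , refl))) = R-subst (sym (vtx-0 m)) refl (star l (s≤s u))
    listed⇒adjacent x y (inj₁ (i , l , u , inj₂ (refl , refl))) = R-sym (R-subst (sym (vtx-0 m)) refl (star l (s≤s u)))
    listed⇒adjacent x y (inj₂ (inj₁ (refl , refl))) = r
    listed⇒adjacent x y (inj₂ (inj₂ (refl , refl))) = R-sym r

    impossible : ⊥
    impossible = ¬config (size , 1≤deg , m , true , inj₁ λ x y →
      adjacent⇒listed (index m x) x y (≤-pred (index< m x)) (vtx-index m x) , listed⇒adjacent x y)

  -- The vertex `v u 1` is alone on its side of the edge; `pendant-edge-across` joins it to every
  -- vertex across, which makes it the hub.
  no-config-A : ∀ {u} → Pendant u → Pendant (v u 2) → R u (v u 2) → ⊥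
  no-config-A {u} pu pw r = ConfigurationA.impossible {v u 1}
    (subst Pendant (sym (vtx-+ u 1 1)) pw)
    (subst Pendant (sym eqN) pu)
    (R-subst (sym (vtx-+ u 1 1)) (sym eqN) (R-sym r))
    (λ {i} l l′ → R-subst refl (sym (vtx-+ u 1 i))
      (pendant-edge-across pu pw r (s≤s (s≤s z≤n)) {1} {suc i} ≤-refl ≤-refl (s≤s l) l′))
    where
    eqN : v (v u 1) N ≡ u
    eqN = trans (vtx-+ u 1 N) (vtx-n u)

  -- Each side of the edge has at least two vertices, all joined to those across, so these have
  -- degree at least 2. Repeating the edge in `G` lifts its pendant ends to degree 2 too, although
  -- `G` has fewer edges than vertices.
  pendant-edge-short : ∀ {u j} → Pendant u → Pendant (v u j) → R u (v u j) → 3 ≤ j → j < 4 + M → ⊥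
  pendant-edge-short {u} {j} pu pw r 3≤j j<4+M =
    <⇒≱ (subst (λ x → 2 ≤ deg G x) (vtx-index u z) (high (index u z) (≤-pred (index< u z)))) (proj₂ low)
    where
    G : EdgeSet (suc N)
    G = (u , v u j) ∷ F
    low : ∃ λ x → deg G x ≤ 1
    low = low-degree-vertex G (s≤s (s≤s F≤))
    z : V
    z = proj₁ low
    j≤N : j ≤ N
    j≤N = ≤-trans (<⇒≤ j<4+M) (n≤1+n _)
    across : ∀ {x y} → 1 ≤ x → x < j → j < y → y ≤ N → R (v u x) (v u y)
    across = pendant-edge-across pu pw r j≤N
    end : ∀ {x} → x ≡ u ⊎ x ≡ v u j → Pendant x → 2 ≤ deg G x
    end i p = subst (2 ≤_) (sym (deg-incident F i)) (s≤s (≤-reflexive (sym p)))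
    two : ∀ {x a b} → a < b → b ≤ N → R x (v u a) → R x (v u b) → 2 ≤ deg G x
    two a<b b≤N r r′ = ≤-trans (adj²⇒2≤deg F r r′ λ e →
      <⇒≢ a<b (vtx-injective u (s≤s (≤-trans (<⇒≤ a<b) b≤N)) (s≤s b≤N) e)) (deg-mono F _ _)
    high : ∀ i → i ≤ N → 2 ≤ deg G (v u i)
    high zero _ = end (inj₁ (vtx-0 u)) (subst Pendant (sym (vtx-0 u)) pu)
    high (suc i) i≤N with <-cmp (suc i) j
    ... | tri≈ _ eq _ = subst (λ i → 2 ≤ deg G (v u i)) (sym eq) (end (inj₂ refl) pw)
    ... | tri< i<j _ _ = two {a = 4 + M} ≤-refl ≤-refl
          (across (s≤s z≤n) i<j j<4+M (n≤1+n _)) (across (s≤s z≤n) i<j (<-trans j<4+M ≤-refl) ≤-refl)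
    ... | tri> _ _ j<i = two {a = 1} {2} ≤-refl (s≤s (s≤s z≤n))
          (R-sym (across ≤-refl (≤-trans (s≤s (s≤s z≤n)) 3≤j) j<i i≤N))
          (R-sym (across (s≤s z≤n) 3≤j j<i i≤N))

  no-pendant-edge : ∀ {u w} → Pendant u → Pendant w → ¬ R u w
  no-pendant-edge {u} {w} pu pw r =
    go (index u w) (≤-pred (index< u w)) (subst Pendant (sym (vtx-index u w)) pw) (R-subst refl (sym (vtx-index u w)) r)
    where
    go : ∀ j → j ≤ N → Pendant (v u j) → ¬ R u (v u j)
    go 0 _ _ r = R-irrefl (R-subst refl (vtx-0 u) r)
    go 1 _ _ r = R-first u r
    go 2 _ pw r = no-config-A pu pw r
    go (suc (suc (suc i))) j≤N pw r with m≤n⇒m<n∨m≡n j≤N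
    ... | inj₂ eq = R-last u (R-subst refl (cong (v u) eq) r)
    ... | inj₁ j<N with m≤n⇒m<n∨m≡n j<N
    ...   | inj₁ j<4+M = pendant-edge-short pu pw r (s≤s (s≤s (s≤s z≤n))) (≤-pred j<4+M)
    -- Seen from the other end of the edge, `u` comes two places later.
    ...   | inj₂ eq = no-config-A pw (subst Pendant (sym eq′) pu) (R-subst refl (sym eq′) (R-sym r))
      where
      eq′ : v (v u (3 + i)) 2 ≡ u
      eq′ = trans (vtx-+ u (3 + i) 2) (trans (cong (v u) (trans (+-comm (3 + i) 2) (cong suc eq))) (vtx-n u))

  -- A pendant vertex preceded by a non-pendant one is joined to the vertex two places before it.
  -- Given two such vertices, fans from both of them triangulate.
  one-end : ∀ s d → Pendant s → ¬ Pendant (v s N) → suc d ≤ N → Pendant (v s (suc d)) → Pendant (v s d)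
  one-end s zero ps _ _ _ = subst Pendant (sym (vtx-0 s)) ps
  one-end s (suc d) ps ¬pN 2+d≤N py with pendant? (v s (suc d))
  ... | yes p = p
  ... | no ¬p = contradiction
        (λ {z} 1≤z z≤N o → pendant-only s ps rs (n≤1+n _) z≤N
          (λ { refl → Sum.[ (λ l → <⇒≱ (s≤s 2+d≤3+M) l) , (λ l → <⇒≱ (n<1+n (4 + M)) l) ] o }))
        (no-span s (s≤s z≤n) (fan-up (s≤s (≤-trans 2+d≤3+M (n≤1+n _)))
          (λ l u → pendant-only s py (R-sym ry) (≤-trans (n≤1+n _) (≤-trans (n≤1+n _) 2+d≤N)) u
            (λ { refl → <⇒≱ l (≤-trans (n≤1+n _) (≤-trans (n≤1+n _) (n≤1+n _))) })))
          ≤-refl)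
    where
    rs′ : R (v s (4 + M)) s
    rs′ = R-subst refl (vtx-n s) (ear s (4 + M) ¬pN)
    rs : R s (v s (4 + M))
    rs = R-sym rs′
    ry : R (v s d) (v s (2 + d))
    ry = ear s d ¬p
    2+d≤4+M : 2 + d ≤ 4 + M
    2+d≤4+M with m≤n⇒m<n∨m≡n 2+d≤N
    ... | inj₁ l = ≤-pred l
    ... | inj₂ refl = contradiction py ¬pN
    -- If `2 + d` were `4 + M`, the pendant vertices `s` and `v s (2 + d)` would be adjacent.
    2+d≤3+M : 2 + d ≤ 3 + M
    2+d≤3+M with m≤n⇒m<n∨m≡n 2+d≤4+M
    ... | inj₁ l = ≤-pred l
    ... | inj₂ refl = contradiction rs (no-pendant-edge ps py)

  -- The triangulation consists of v s a, v s b, v s (1 + i) and fans from the first two of these.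
  far-crossing : ∀ s {i j a b} → 2 + i ≤ j → j < a → a < b → b ≤ N →
    Pendant (v s a) → R (v s a) (v s i) → Pendant (v s b) → R (v s b) (v s j) → ⊥
  far-crossing s {i} {j} {a} {b} 2+i≤j j<a a<b b≤N pa ra pb rb =
    no-span t {c + suc i} {c + a} (≤-trans (s≤s z≤n) (m≤n+m (suc i) c))
      (fan-down (+-monoʳ-< c (<-trans 2+i≤j j<a))
        (λ {z} l u r → pendant-only t (subst Pendant (sym (shift-index a)) pa)
          (R-subst (sym (shift-index a)) (sym (shift-index i)) ra)
          (≤-trans (+-monoʳ-≤ c (<⇒≤ (<-trans (≤-trans (n≤1+n _) 2+i≤j) j<a))) c+a≤N)
          (≤-trans (≤-trans (n≤1+n _) (<⇒≤ u)) c+a≤N)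
          (λ { refl → <⇒≱ (+-monoʳ-< c ≤-refl) l }) (R-sym r)))
      c+a≤N
      (λ {z} 1≤z z≤N o → pendant-only t pb (R-subst refl (sym (shift-index j)) rb)
        (≤-trans (+-monoʳ-≤ c (<⇒≤ j<a)) c+a≤N) z≤N
        (λ { refl → Sum.[ (λ l → <⇒≱ (+-monoʳ-< c 2+i≤j) l) , (λ l → <⇒≱ (+-monoʳ-< c j<a) l) ] o }))
    where
    t = v s b
    -- Passing to labels based at `t` adds `c`, modulo the period.
    c = suc N ∸ b
    b+c : b + c ≡ suc N
    b+c = m+[n∸m]≡n (≤-trans b≤N (n≤1+n _))
    c+a≤N : c + a ≤ N
    c+a≤N = ≤-pred (subst (c + a <_) (trans (+-comm c b) b+c) (+-monoʳ-< c a<b))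
    shift-index : ∀ x → v t (c + x) ≡ v s x
    shift-index x = trans (vtx-+ s b (c + x)) (trans (cong (v s)
      (trans (sym (+-assoc b c x)) (trans (cong (_+ x) b+c) (+-comm (suc N) x)))) (vtx-period s x))

  -- The block of non-pendant vertices and configuration (b)

  module Block (s : V) (k′ : ℕ) (k≤N : 2 + k′ ≤ N) (pk : Pendant (v s (2 + k′)))
    (inner : ∀ {i} → i < 2 + k′ → ¬ Pendant (v s i)) (pN : Pendant (v s N)) where

    k : ℕ
    k = 2 + k′

    -- After a non-pendant `v s i`, the next pendant vertex would, like `v s k`, follow a
    -- non-pendant one, against `one-end`.
    outer : ∀ {i} → k ≤ i → i ≤ N → Pendant (v s i)
    outer {i} k≤i i≤N with pendant? (v s i)
    ... | yes p = p
    ... | no ¬p with least (λ d → pendant? (v s (i + d))) (N ∸ i)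
                       (subst (λ z → Pendant (v s z)) (sym (m+[n∸m]≡n i≤N)) pN)
    ...   | zero , _ , p , _ = subst (λ z → Pendant (v s z)) (+-identityʳ i) p
    ...   | suc e , e≤ , p , before = contradiction
            (subst Pendant (trans (vtx-+ s k (c + e)) (cong (v s) eq))
              (one-end (v s k) (c + e) pk
                (λ p → inner (n<1+n _) (subst Pendant (vtx-pred s (1 + k′)) p))
                (≤-trans (m≤n+m _ k) (subst (_≤ N) (sym eq′) (subst (i + suc e ≤_) (m+[n∸m]≡n i≤N) (+-monoʳ-≤ i e≤))))
                (subst Pendant (sym (trans (vtx-+ s k (suc (c + e))) (cong (v s) eq′))) p)))
            (before (n<1+n e))
      where
      c = i ∸ k
      eq : k + (c + e) ≡ i + e
      eq = trans (sym (+-assoc k c e)) (cong (_+ e) (m+[n∸m]≡n k≤i))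
      eq′ : k + suc (c + e) ≡ i + suc e
      eq′ = trans (+-suc k (c + e)) (trans (cong suc eq) (sym (+-suc i e)))

    -- The degree sum is at least `2k + (n - k)` and at most `2(n - 2)`.
    k≤ : k ≤ 2 + M
    k≤ = +-cancelʳ-≤ (6 + M) k (2 + M) (begin
      k + (6 + M)                                  ≡⟨ cong (k +_) (sym k+m) ⟩
      k + (k + m)                                  ≡⟨ solve 2 (λ k m → k :+ (k :+ m) := k :* con 2 :+ m :* con 1) refl k m ⟩
      k * 2 + m * 1                                ≡⟨ cong₂ (λ x y → x * 2 + y * 1) (sym (length-range (v s) 0 k)) (sym (length-range (v s) k m)) ⟩
      length A * 2 + length B * 1                  ≤⟨ +-mono-≤ (length*≤sum (deg F) 2 A (All.lookup (range-all (v s) 0 k (λ _ l → ¬pendant⇒2≤deg (inner l)))))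
                                                        (length*≤sum (deg F) 1 B (λ {x} _ → 1≤deg x)) ⟩
      sum (map (deg F) A) + sum (map (deg F) B)    ≡⟨ sym (trans (cong sum (map-++ (deg F) A B)) (sum-++ (map (deg F) A) _)) ⟩
      sum (map (deg F) (A ++ B))                   ≡⟨ cong (λ L → sum (map (deg F) L)) (trans (sym (range-++ (v s) 0 k m)) (cong (range (v s) 0) k+m)) ⟩
      sum (map (deg F) (polygon s))                ≤⟨ sum-deg≤ F (polygon-unique s) ⟩
      length F + length F                          ≤⟨ +-mono-≤ F≤ F≤ ⟩
      (4 + M) + (4 + M)                            ≡⟨ solve 1 (λ M → (con 4 :+ M) :+ (con 4 :+ M) := (con 2 :+ M) :+ (con 6 :+ M)) refl M ⟩
      (2 + M) + (6 + M) ∎)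
      where
      open ≤-Reasoning
      open +-*-Solver
      m = suc N ∸ k
      A = range (v s) 0 k
      B = range (v s) k m
      k+m : k + m ≡ suc N
      k+m = m+[n∸m]≡n (≤-trans k≤N (n≤1+n _))

    -- The vertex before `v s i` gets the label `i + N`, so `i = 0` is not a special case.
    inner-ear : ∀ i → i < k → 2 ≤ deg F (v s i) × R (v s (i + suc N ∸ 1)) (v s (suc i))
    inner-ear i l = ¬pendant⇒2≤deg (inner l) ,
      R-subst (cong (λ j → v s (j ∸ 1)) (sym (+-suc i N)))
              (trans (cong (λ j → v s (suc j)) (sym (+-suc i N))) (vtx-period s (suc i)))
              (ear s (i + N) (λ p → inner l (subst Pendant eq p)))
      where
      eq : v s (suc (i + N)) ≡ v s i
      eq = trans (cong (v s) (sym (+-suc i N))) (vtx-period s i)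

    outer-neighbour : ∀ i → k ≤ i → i < suc N → Pendant (v s i) × Σ V λ w → R (v s i) w × deg F w ≢ 1
    outer-neighbour i l u with outer l (≤-pred u) | neighbour (v s i)
    ... | p | w , r = p , w , r , λ pw → no-pendant-edge p pw r

    neighbour-index< : ∀ {x} i → i ≤ N → Pendant x → R x (v s i) → i < k
    neighbour-index< i i≤N p r with k ≤? i
    ... | yes l = contradiction r (no-pendant-edge p (outer l i≤N))
    ... | no ¬l = ≰⇒> ¬l

    -- Neighbours of pendant vertices lie in the block, so `i` and `j` are below `a` and `b`. If the
    -- two pairs are ordered oppositely, the chords are nested; if alike, `far-crossing` excludes a
    -- gap of 2 or more.
    near-crossing : ∀ a b i j → a ≤ N → b ≤ N → i ≤ N → j ≤ N →
      Pendant (v s a) → Pendant (v s b) → R (v s a) (v s i) → R (v s b) (v s j) →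
      Cross (v s a) (v s i) (v s b) (v s j) → i ≡ suc j ⊎ j ≡ suc i
    near-crossing a b i j a≤N b≤N i≤N j≤N pa pb ra rb x = go
      where
      i<k = neighbour-index< i i≤N pa ra
      j<k = neighbour-index< j j≤N pb rb
      k≤a : k ≤ a
      k≤a = ≮⇒≥ (λ l → inner l pa)
      k≤b : k ≤ b
      k≤b = ≮⇒≥ (λ l → inner l pb)
      go : i ≡ suc j ⊎ j ≡ suc i
      go with <-cmp i j | <-cmp a b
      ... | tri≈ _ refl _ | _ = contradiction x no-cross-common
      ... | tri< i<j _ _ | tri≈ _ refl _ =
            contradiction (vtx-injective s (s≤s i≤N) (s≤s j≤N) (pendant-unique pa ra rb)) (<⇒≢ i<j)
      ... | tri> _ _ j<i | tri≈ _ refl _ =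
            contradiction (vtx-injective s (s≤s j≤N) (s≤s i≤N) (pendant-unique pa rb ra)) (<⇒≢ j<i)
      ... | tri< i<j _ _ | tri< a<b _ _ with m≤n⇒m<n∨m≡n i<j
      ...   | inj₂ eq = inj₂ (sym eq)
      ...   | inj₁ l = ⊥-elim (far-crossing s l (<-≤-trans j<k k≤a) a<b b≤N pa ra pb rb)
      go | tri> _ _ j<i | tri> _ _ b<a with m≤n⇒m<n∨m≡n j<i
      ...   | inj₂ eq = inj₁ (sym eq)
      ...   | inj₁ l = ⊥-elim (far-crossing s l (<-≤-trans i<k k≤b) b<a a≤N pb rb pa ra)
      go | tri< i<j _ _ | tri> _ _ b<a = contradiction x (arc-no-cross
            (inj₂ (inj₂ (cyc-rot (cyc-rot (cyc-vtx s (<-≤-trans i<k k≤b) b<a (s≤s a≤N))))))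
            (inj₂ (inj₂ (cyc-rot (cyc-rot (cyc-vtx s i<j (<-≤-trans j<k k≤a) (s≤s a≤N)))))))
      go | tri> _ _ j<i | tri< a<b _ _ = contradiction (cross-swapˡ x) (arc-no-cross
            (inj₂ (inj₂ (cyc-vtx s (<-≤-trans i<k k≤a) a<b (s≤s b≤N))))
            (inj₂ (inj₂ (cyc-rot (cyc-vtx s j<i (<-≤-trans i<k k≤a) (s≤s a≤N))))))

    impossible : ⊥
    impossible = ¬config (size , 1≤deg , s , true , inj₂ (k , s≤s (s≤s z≤n) , k≤ , inner-ear , outer-neighbour ,
      λ u w i j i<n j<n pu pw ru rw x → near-crossing (index s u) (index s w) i j
        (≤-pred (index< s u)) (≤-pred (index< s w)) (≤-pred i<n) (≤-pred j<n)
        (subst Pendant (sym (vtx-index s u)) pu) (subst Pendant (sym (vtx-index s w)) pw)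
        (R-subst (sym (vtx-index s u)) refl ru) (R-subst (sym (vtx-index s w)) refl rw)
        (subst₂ (λ u w → Cross u (v s i) w (v s j)) (sym (vtx-index s u)) (sym (vtx-index s w)) x)))

  -- Locating the block

  pendant-vertex : ∃ λ p → Pendant p
  pendant-vertex = Product.map₂ (λ d → ≤-antisym d (1≤deg _)) (low-degree-vertex F (≤-trans (s≤s F≤) (n≤1+n _)))

  FirstPendant : V → ℕ → Set
  FirstPendant s k = k ≤ N × Pendant (v s k) × (∀ {i} → i < k → ¬ Pendant (v s i))

  -- The block starts at `v s 1`. If it were a single vertex, its ear chord would join two pendant
  -- vertices; hence the length of at least 2 that `Block` requires.
  impossible-from : ∀ s → Pendant (v s 0) → ¬ Pendant (v s 1) → ∃ (FirstPendant (v s 1)) → ⊥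
  impossible-from s p₀ ¬p₁ (zero , _ , p , _) = ¬p₁ (subst Pendant (vtx-0 (v s 1)) p)
  impossible-from s p₀ ¬p₁ (suc zero , _ , p , _) =
    no-pendant-edge p₀ (subst Pendant (vtx-suc s 1) p) (ear s 0 ¬p₁)
  impossible-from s p₀ ¬p₁ (suc (suc k′) , k≤N , p , inner) =
    Block.impossible (v s 1) k′ k≤N p inner (subst Pendant (sym (vtx-pred s 0)) p₀)

  -- The double negation is what `least` yields for the negated predicate; it suffices because the
  -- goal is `⊥`.
  FirstNonPendant : V → ℕ → Set
  FirstNonPendant p t = ¬ Pendant (v p t) × (∀ {i} → i < t → ¬ ¬ Pendant (v p i))

  impossible-around : ∀ p → Pendant p → ∃ (FirstNonPendant p) → ⊥
  impossible-around p pp (zero , ¬p , _) = ¬p (subst Pendant (sym (vtx-0 p)) pp)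
  impossible-around p pp (suc t , ¬p , before) =
    before (n<1+n t) λ pt → impossible-from s (subst Pendant (sym (vtx-0 s)) pt) ¬p₁
      (least (λ i → pendant? (v (v s 1) i)) N (subst Pendant (sym last) pt))
    where
    s : V
    s = v p t
    ¬p₁ : ¬ Pendant (v s 1)
    ¬p₁ p₁ = ¬p (subst Pendant (vtx-suc p t) p₁)
    last : v (v s 1) N ≡ s
    last = trans (vtx-pred s 0) (vtx-0 s)

  impossible : ⊥
  impossible = impossible-around p pp (Product.map₂ proj₂ (least (λ i → ¬? (pendant? (v p i))) (index p q)
      -- The neighbour of `p` is non-pendant, so the search for a non-pendant vertex succeeds.
      (λ pq → no-pendant-edge pp (subst Pendant (vtx-index p q) pq) (proj₂ (neighbour p)))))
    where
    p : V
    p = proj₁ pendant-vertex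
    pp : Pendant p
    pp = proj₂ pendant-vertex
    q : V
    q = proj₁ (neighbour p)

theorem2 : (n : ℕ) → 6 ≤ n → (F : EdgeSet n) → WellFormed F →
    length F ≤ n ∸ 2 → (∀ (a b : Fin n) → IsBoundary a b → ¬ Adj F a b) →
    ¬ HasConfigStar n F → AdmitsTriangulation n F
theorem2 _ (s≤s (s≤s (s≤s (s≤s (s≤s (s≤s (z≤n {M}))))))) F wf F≤ ∂∉F ¬config =
  decidable-stable (admitsTriangulation? (6 + M) F)
    (λ blocked → Blocking.impossible F wf F≤ ∂∉F blocked ¬config)
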